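{- Deciding whether $\nu_d(G)=\nu_s(G)$ can be done in polynomial time for graphs of bounded degree; that is, for every fixed constant $D$, there is a polynomial-time algorithm that, given a graph $G$ with maximum degree $\Delta(G)\le D$, decides whether $\nu_d(G)=\nu_s(G)$.
   Context: All graphs are finite, simple and undirected. For a matching $M$ of $G$, $G[M]$ denotes the subgraph of $G$ induced by the set $V(M)$ of endpoints of edges of $M$. A matching $M$ is disconnected if $G[M]$ is disconnected or $M$ is empty; $\nu_d(G)$ is the maximum size of a disconnected matching of $G$. A matching $M$ is induced if $G[M]$ is $1$-regular or empty; $\nu_s(G)$ is the maximum size of an induced matching of $G$. -}

module Defs where

open import Data.Bool.Base using (Bool; true; false)
open import Data.Fin.Base using (Fin)
open import Data.Fin.Subset using (Subset; _∈_; _∩_; _∪_; ⋃; ⁅_⁆; ∣_∣)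
open import Data.List.Base using (List; []; _∷_; length; map; allFin)
open import Data.List.Extrema.Nat using (max)
open import Data.List.Relation.Unary.All using (All)
open import Data.List.Relation.Unary.AllPairs using (AllPairs)
open import Data.Nat.Base using (ℕ; _+_; _*_; _^_; _≤_)
open import Data.Nat.Properties using (_≟_)
open import Data.Product.Base using (∃-syntax; _×_; _,_)
open import Data.Sum.Base using (_⊎_)
open import Data.Vec.Base using (tabulate)
open import Function.Bundles using (_⇔_)
open import Relation.Binary.Construct.Closure.ReflexiveTransitive using (Star)
open import Relation.Binary.PropositionalEquality using (_≡_; _≢_)
open import Relation.Nullary using (¬_; yes; no)

------------------------------------------------------------------------
-- Graphs

record Graph : Set where
  field
    order  : ℕ
    adj    : Fin order → Fin order → Bool
    sym    : ∀ u v → adj u v ≡ adj v u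
    irrefl : ∀ u → adj u u ≡ false

  Vertex : Set
  Vertex = Fin order

  Adj : Vertex → Vertex → Set
  Adj u v = adj u v ≡ true

  neighbours : Vertex → Subset order
  neighbours u = tabulate (adj u)

  degree : Vertex → ℕ
  degree u = ∣ neighbours u ∣

  Δ : ℕ
  Δ = max 0 (map degree (allFin order))

  -- The subgraph G[U] induced by U, given by its adjacency relation and
  -- its degrees.

  InducedAdj : Subset order → Vertex → Vertex → Set
  InducedAdj U u v = u ∈ U × v ∈ U × Adj u v

  inducedDegree : Subset order → Vertex → ℕ
  inducedDegree U u = ∣ neighbours u ∩ U ∣

  InducedConnected : Subset order → Set
  InducedConnected U = ∀ u v → u ∈ U → v ∈ U → Star (InducedAdj U) u v

  InducedRegular : ℕ → Subset order → Set
  InducedRegular r U = ∀ u → u ∈ U → inducedDegree U u ≡ r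

  -- A set of edges is listed without repetition, each edge by its two
  -- endpoints in either order.  In a matching the edges are pairwise
  -- disjoint, so there can be no repetition, and the size of the matching
  -- is the length of the list.

  EndpointPair : Set
  EndpointPair = Vertex × Vertex

  IsEdge : EndpointPair → Set
  IsEdge (u , v) = Adj u v

  ends : EndpointPair → Subset order
  ends (u , v) = ⁅ u ⁆ ∪ ⁅ v ⁆

  Disjoint : EndpointPair → EndpointPair → Set
  Disjoint (u , v) (x , y) = u ≢ x × u ≢ y × v ≢ x × v ≢ y

  Matching : List EndpointPair → Set
  Matching M = All IsEdge M × AllPairs Disjoint M

  V : List EndpointPair → Subset order
  V M = ⋃ (map ends M)

  DisconnectedMatching : List EndpointPair → Set
  DisconnectedMatching M = Matching M × (¬ InducedConnected (V M) ⊎ M ≡ [])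

  InducedMatching : List EndpointPair → Set
  InducedMatching M = Matching M × (InducedRegular 1 (V M) ⊎ M ≡ [])

  IsMaximumSize : (List EndpointPair → Set) → ℕ → Set
  IsMaximumSize P k =
    (∃[ M ] P M × length M ≡ k) × (∀ M → P M → length M ≤ k)

  -- The parameters ν_d(G) and ν_s(G), as relations.

  ν-d≡ : ℕ → Set
  ν-d≡ = IsMaximumSize DisconnectedMatching

  ν-s≡ : ℕ → Set
  ν-s≡ = IsMaximumSize InducedMatching

-- Both maxima exist, the empty matching being disconnected and induced,
-- and are unique, so a common value exists exactly when they are equal.
ν-d≡ν-s : Graph → Set
ν-d≡ν-s G = ∃[ k ] Graph.ν-d≡ G k × Graph.ν-s≡ G k

------------------------------------------------------------------------
-- Polynomial time
--
-- The machine model is the WHILE language of N. D. Jones, "Computability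
-- and Complexity from a Programming Perspective" (MIT Press, 1997), with
-- his unit-cost time measure; equality tests on trees are left out.  It
-- defines the same polynomial-time decidable problems as Turing machines:
-- trees are represented by pointers with sharing, so that t units of time
-- allocate at most t new nodes even when the trees they denote are
-- exponentially large.

data Tree : Set where
  nil  : Tree
  cons : Tree → Tree → Tree

size : Tree → ℕ
size nil        = 1
size (cons a b) = 1 + size a + size b

head : Tree → Tree
head nil        = nil
head (cons a _) = a

tail : Tree → Tree
tail nil        = nil
tail (cons _ b) = b

Var : Set
Var = ℕ

data Expr : Set where
  var   : Var → Expr
  nilᵉ  : Expr
  consᵉ : Expr → Expr → Expr
  hd tl : Expr → Expr

infix  6 _:=_
infixr 5 if_then_else_ while_loop_
infixr 4 _⨾_

data Program : Set where
  _:=_           : Var → Expr → Program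
  _⨾_            : Program → Program → Program
  if_then_else_  : Expr → Program → Program → Program
  while_loop_    : Expr → Program → Program

Store : Set
Store = Var → Tree

_[_↦_] : Store → Var → Tree → Store
(σ [ x ↦ d ]) y with x ≟ y
... | yes _ = d
... | no  _ = σ y

eval : Expr → Store → Tree
eval (var x)     σ = σ x
eval nilᵉ        σ = nil
eval (consᵉ e f) σ = cons (eval e σ) (eval f σ)
eval (hd e)      σ = head (eval e σ)
eval (tl e)      σ = tail (eval e σ)

cost : Expr → ℕ
cost (var _)     = 1
cost nilᵉ        = 1
cost (consᵉ e f) = 1 + cost e + cost f
cost (hd e)      = 1 + cost e
cost (tl e)      = 1 + cost e

-- ⟨ p , σ ⟩⇓ σ′ [ t ]: started in store σ, the program p halts in store σ′
-- after time t.  A test succeeds when its value is not nil.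
data ⟨_,_⟩⇓_[_] : Program → Store → Store → ℕ → Set where

  assign : ∀ {x e σ} →
    ⟨ x := e , σ ⟩⇓ (σ [ x ↦ eval e σ ]) [ 1 + cost e ]

  seq : ∀ {p q σ σ′ σ″ s t} →
    ⟨ p , σ ⟩⇓ σ′ [ s ] → ⟨ q , σ′ ⟩⇓ σ″ [ t ] →
    ⟨ p ⨾ q , σ ⟩⇓ σ″ [ s + t ]

  if-true : ∀ {e p q σ σ′ t} →
    eval e σ ≢ nil → ⟨ p , σ ⟩⇓ σ′ [ t ] →
    ⟨ if e then p else q , σ ⟩⇓ σ′ [ 1 + cost e + t ]

  if-false : ∀ {e p q σ σ′ t} →
    eval e σ ≡ nil → ⟨ q , σ ⟩⇓ σ′ [ t ] →
    ⟨ if e then p else q , σ ⟩⇓ σ′ [ 1 + cost e + t ]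

  while-true : ∀ {e p σ σ′ σ″ s t} →
    eval e σ ≢ nil →
    ⟨ p , σ ⟩⇓ σ′ [ s ] → ⟨ while e loop p , σ′ ⟩⇓ σ″ [ t ] →
    ⟨ while e loop p , σ ⟩⇓ σ″ [ 1 + cost e + s + t ]

  while-false : ∀ {e p σ} →
    eval e σ ≡ nil →
    ⟨ while e loop p , σ ⟩⇓ σ [ 1 + cost e ]

-- Variable 0 holds the input at the start and the output at the end.
initial : Tree → Store
initial d = (λ _ → nil) [ 0 ↦ d ]

output : Store → Tree
output σ = σ 0

-- A problem with instances in I, restricted to those satisfying Promise.
-- The answer is "yes" when the output is not nil.  Every polynomial is
-- bounded by some c * n ^ k for n ≥ 1, and size is never 0.
PolynomialTimeDecidable :
  {I : Set} (encode : I → Tree) (Promise Yes : I → Set) → Set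
PolynomialTimeDecidable {I} encode Promise Yes =
  ∃[ p ] ∃[ c ] ∃[ k ] ((i : I) → Promise i →
    ∃[ σ ] ∃[ t ] ⟨ p , initial (encode i) ⟩⇓ σ [ t ]
                × t ≤ c * size (encode i) ^ k
                × (Yes i ⇔ output σ ≢ nil))

------------------------------------------------------------------------
-- Graphs as inputs: the adjacency matrix, as the list of its rows

encodeBool : Bool → Tree
encodeBool false = nil
encodeBool true  = cons nil nil

encodeList : {A : Set} → (A → Tree) → List A → Tree
encodeList f []       = nil
encodeList f (x ∷ xs) = cons (f x) (encodeList f xs)

encodeGraph : Graph → Tree
encodeGraph G =
  encodeList (λ u → encodeList (λ v → encodeBool (adj u v)) (allFin order))
             (allFin order)
  where open Graph G

{-# OPTIONS --safe #-}

-- If ν_d = ν_s = k ≥ 2D + 2, take an induced matching M of size k.  Replacing at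
-- most one edge of M by edges that meet at most two vertices a, b outside
-- V(M) leaves some edge of M separated from all the others, since a and b have
-- at most 2D neighbours; so such an exchange cannot enlarge M.  Hence the
-- vertices outside V(M) are independent, and every edge of M has an end of
-- degree 1, or both its ends have degree 2 and a common neighbour outside V(M):
-- a local condition, found by Cameron and Walker for graphs with ν = ν_s.
-- Conversely, under this condition an edge of any matching can be replaced by a
-- nearby pendant edge or triangle edge so that the result is induced.  So
-- ν_s = ν, and then ν_d = ν_s as soon as ν_s ≥ 2.
--
-- The local condition, and for each of the remaining values of k the equation
-- ν_d = ν_s = k, are first-order properties of the graph, and a fixed
-- first-order formula is decided in polynomial time by nested loops over the
-- vertices.
module Submission where

open import Defs
open import Data.Bool.Base using (true; false)
import Data.Bool.Properties as Bool
open import Data.Empty using (⊥; ⊥-elim)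
open import Data.Fin.Base as Fin using (Fin; zero; suc; toℕ; fromℕ<)
import Data.Fin.Properties as Fin
open import Data.Fin.Subset as Subset
  using (Subset; inside; outside; _∈_; _∉_; _∩_; _∪_; _-_; ⁅_⁆; ∣_∣)
open import Data.Fin.Subset.Properties
  using ( _∈?_; ∉⊥; ∈⊤; x∈⁅x⁆; x∈⁅y⁆⇒x≡y; ∣⁅x⁆∣≡1; ⊆-antisym; x∈p∩q⁺; x∈p∩q⁻; x∈p∪q⁺; x∈p∪q⁻
        ; x∈p⇒∣p-x∣<∣p∣; x∈p∧x≢y⇒x∈p-y; ∣p∣≤n)
open import Data.List.Base
  using (List; []; _∷_; _++_; length; map; tabulate; allFin; take; drop; upTo)
open import Data.List.Extrema.Nat using (xs≤max)
open import Data.List.Membership.Propositional as List using (find; lose)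
open import Data.List.Membership.Propositional.Properties
  using (∈-∃++; ∈-map⁺; ∈-allFin; ∈-upTo⁺; ∈-upTo⁻; ∈-AllPairs₂; ∈-++⁺ˡ; ∈-++⁺ʳ)
open import Data.List.Properties
  using ( length-tabulate; length-map; length-++; length-take; length-drop
        ; map-∘; take-map; drop-map; take++drop≡id)
open import Data.List.Relation.Binary.Permutation.Propositional
  using (_↭_; ↭-refl; ↭-sym; ↭-trans; ↭⇒↭ₛ)
open import Data.List.Relation.Binary.Permutation.Propositional.Properties
  using (All-resp-↭; ∈-resp-↭; ↭-length; shift; ++⁺ˡ)
import Data.List.Relation.Binary.Permutation.Setoid.Properties as Permutation
open import Data.List.Relation.Unary.All as All using (All; []; _∷_)
import Data.List.Relation.Unary.All.Properties as All
open import Data.List.Relation.Unary.AllPairs as AllPairs using (AllPairs; []; _∷_)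
import Data.List.Relation.Unary.AllPairs.Properties as AllPairs
open import Data.List.Relation.Unary.Any as Any using (Any; here; there)
import Data.List.Relation.Unary.Any.Properties as Any
open import Data.Nat.Base
open import Data.Nat.Properties
open import Data.Product.Base using (∃-syntax; _×_; _,_; proj₁; proj₂)
open import Data.Sum.Base as Sum using (_⊎_; inj₁; inj₂; [_,_]′)
open import Data.Unit.Base using (⊤)
open import Data.Vec.Base using (Vec; []; _∷_; lookup)
open import Data.Vec.Properties using (lookup∘tabulate; lookup⇒[]=; []=⇒lookup)
open import Function.Base using (_∘_; id; case_of_)
open import Function.Bundles using (_⇔_; mk⇔; Equivalence)
open import Relation.Binary.Construct.Closure.ReflexiveTransitive using (Star; ε; _◅_; _◅◅_; reverse)
open import Relation.Binary.Definitions using (Symmetric; tri<; tri≈; tri>)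
open import Relation.Binary.PropositionalEquality
open import Relation.Nullary using (¬_; Dec; yes; no; contradiction)
open import Relation.Nullary.Decidable using (decidable-stable; ¬?; _×-dec_; _⊎-dec_)

open Equivalence using (to; from)

-- Timed computations

-- `n` is kept positive so that two bounds can be raised to a common exponent.
Polynomial : (ℕ → ℕ) → Set
Polynomial T = ∃[ c ] ∃[ k ] (∀ n → .{{NonZero n}} → T n ≤ c * n ^ k)

poly-const : ∀ a → Polynomial (λ _ → a)
poly-const a = a , 0 , λ _ → ≤-reflexive (sym (*-identityʳ a))

poly-id : Polynomial id
poly-id = 1 , 1 , λ n → ≤-reflexive (sym (trans (*-identityˡ (n ^ 1)) (*-identityʳ n)))

poly-+ : ∀ {S T} → Polynomial S → Polynomial T → Polynomial (λ n → S n + T n)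
poly-+ {S} {T} (c , k , S≤) (d , l , T≤) = c + d , k + l , bound
  where
  bound : ∀ n → .{{NonZero n}} → S n + T n ≤ (c + d) * n ^ (k + l)
  bound n = begin
    S n + T n                               ≤⟨ +-mono-≤ (S≤ n) (T≤ n) ⟩
    c * n ^ k + d * n ^ l                   ≤⟨ +-mono-≤ (*-monoʳ-≤ c (^-monoʳ-≤ n (m≤m+n k l)))
                                                        (*-monoʳ-≤ d (^-monoʳ-≤ n (m≤n+m l k))) ⟩
    c * n ^ (k + l) + d * n ^ (k + l)       ≡⟨ *-distribʳ-+ (n ^ (k + l)) c d ⟨
    (c + d) * n ^ (k + l)                   ∎
    where open ≤-Reasoning

poly-* : ∀ {S T} → Polynomial S → Polynomial T → Polynomial (λ n → S n * T n)
poly-* {S} {T} (c , k , S≤) (d , l , T≤) = c * d , k + l , bound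
  where
  bound : ∀ n → .{{NonZero n}} → S n * T n ≤ c * d * n ^ (k + l)
  bound n = begin
    S n * T n                   ≤⟨ *-mono-≤ (S≤ n) (T≤ n) ⟩
    c * n ^ k * (d * n ^ l)     ≡⟨ [m*n]*[o*p]≡[m*o]*[n*p] c (n ^ k) d (n ^ l) ⟩
    c * d * (n ^ k * n ^ l)     ≡⟨ cong (c * d *_) (^-distribˡ-+-* n k l) ⟨
    c * d * n ^ (k + l)         ∎
    where open ≤-Reasoning

update-same : ∀ σ x d → (σ [ x ↦ d ]) x ≡ d
update-same σ x d with x ≟ x
... | yes _   = refl
... | no x≢x = contradiction refl x≢x

update-other : ∀ σ {x y} d → x ≢ y → (σ [ x ↦ d ]) y ≡ σ y
update-other σ {x} {y} d x≢y with x ≟ y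
... | yes x≡y = contradiction x≡y x≢y
... | no _    = refl

-- A total-correctness triple with a time bound. `T` is an upper bound, so it can be stated without
-- knowing which branches the run takes.
Halts : Program → Store → ℕ → (Store → Set) → Set
Halts p σ T Q = ∃[ σ′ ] ∃[ t ] ⟨ p , σ ⟩⇓ σ′ [ t ] × t ≤ T × Q σ′

infixr 4 _⨟_

_⨟_ : ∀ {p q σ S T} {P Q : Store → Set} →
      Halts p σ S P → (∀ σ′ → P σ′ → Halts q σ′ T Q) → Halts (p ⨾ q) σ (S + T) Q
(σ′ , s , p⇓ , s≤S , Pσ′) ⨟ k =
  let σ″ , t , q⇓ , t≤T , Qσ″ = k σ′ Pσ′
  in  σ″ , s + t , seq p⇓ q⇓ , +-mono-≤ s≤S t≤T , Qσ″

assigns : ∀ {x e σ} {Q : Store → Set} →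
          Q (σ [ x ↦ eval e σ ]) → Halts (x := e) σ (1 + cost e) Q
assigns q = _ , _ , assign , ≤-refl , q

relax : ∀ {p σ S T} {P Q : Store → Set} →
        S ≤ T → (∀ {σ′} → P σ′ → Q σ′) → Halts p σ S P → Halts p σ T Q
relax S≤T f (σ′ , t , p⇓ , t≤S , Pσ′) = σ′ , t , p⇓ , ≤-trans t≤S S≤T , f Pσ′

trueᵉ : Expr
trueᵉ = consᵉ nilᵉ nilᵉ

nil? : ∀ d → d ≡ nil ⊎ d ≢ nil
nil? nil        = inj₁ refl
nil? (cons _ _) = inj₂ λ ()

tails : ℕ → Tree → Tree
tails zero    d = d
tails (suc k) d = tails k (tail d)

tail-tails : ∀ k d → tail (tails k d) ≡ tails (suc k) d
tail-tails zero    d = refl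
tail-tails (suc k) d = tail-tails k (tail d)

unary : ℕ → Tree
unary zero    = nil
unary (suc k) = cons (cons nil nil) (unary k)

-- Every digit of `unary` differs from nil, so reading position `k` of the numeral of `l` decides
-- `k < l`. The same access reads a bit from a row of the matrix, and one program, `entry`, serves
-- both.
head-tails-unary : ∀ k l → head (tails k (unary l)) ≢ nil ⇔ k < l
head-tails-unary k       zero    = mk⇔ (λ ≢nil → contradiction (head-tails-nil k) ≢nil) λ ()
  where
  head-tails-nil : ∀ k → head (tails k nil) ≡ nil
  head-tails-nil zero    = refl
  head-tails-nil (suc k) = head-tails-nil k
head-tails-unary zero    (suc l) = mk⇔ (λ _ → z<s) λ _ ()
head-tails-unary (suc k) (suc l) =
  mk⇔ (s<s ∘ to (head-tails-unary k l)) (from (head-tails-unary k l) ∘ s<s⁻¹)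

module _ {A : Set} (f : A → Tree) where

  head-tails-encode : ∀ {n} (g : Fin n → A) i →
                      head (tails (toℕ i) (encodeList f (tabulate g))) ≡ f (g i)
  head-tails-encode g zero    = refl
  head-tails-encode g (suc i) = head-tails-encode (g ∘ suc) i

  tails-encode≢nil : ∀ {n} (g : Fin n → A) (i : Fin n) →
                     tails (toℕ i) (encodeList f (tabulate g)) ≢ nil
  tails-encode≢nil g zero    = λ ()
  tails-encode≢nil g (suc i) = tails-encode≢nil (g ∘ suc) i

  tails-encode≡nil : ∀ {n} (g : Fin n → A) →
                     tails n (encodeList f (tabulate g)) ≡ nil
  tails-encode≡nil {zero}  g = refl
  tails-encode≡nil {suc n} g = tails-encode≡nil (g ∘ suc)

  length≤size-encode : ∀ xs → length xs ≤ size (encodeList f xs)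
  length≤size-encode []       = z≤n
  length≤size-encode (x ∷ xs) =
    s≤s (≤-trans (length≤size-encode xs) (m≤n+m _ (size (f x))))

encodeBool≢nil : ∀ {b} → encodeBool b ≢ nil ⇔ b ≡ true
encodeBool≢nil {false} = mk⇔ (λ ≢nil → contradiction refl ≢nil) λ ()
encodeBool≢nil {true}  = mk⇔ (λ _ → refl) λ _ ()

row : (G : Graph) → Graph.Vertex G → Tree
row G u = encodeList (λ v → encodeBool (Graph.adj G u v)) (allFin (Graph.order G))

size-nonZero : ∀ d → NonZero (size d)
size-nonZero nil        = _
size-nonZero (cons _ _) = _

order≤size : ∀ G → Graph.order G ≤ size (encodeGraph G)
order≤size G = subst (_≤ size (encodeGraph G)) (length-tabulate id)
                     (length≤size-encode _ (allFin (Graph.order G)))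

-- First-order definability

-- Variable 0 holds the result, 1 is scratch and 2 holds the adjacency matrix.
-- The vertex bound by the m-th quantifier occupies two variables: the rows of
-- the matrix from its own row on, and its number in unary.
slot : ℕ → Var
slot zero    = 3
slot (suc m) = 2 + slot m

2<slot : ∀ m → 2 < slot m
2<slot zero    = ≤-refl
2<slot (suc m) = m≤n⇒m≤1+n (m≤n⇒m≤1+n (2<slot m))

-- The innermost bound vertex comes first in a vector, as with de Bruijn indices, so index zero
-- belongs to the last slot in use.
slotOf : ∀ {m} → Fin m → Var
slotOf {suc m} zero    = slot m
slotOf {suc m} (suc i) = slotOf i

module _ (G : Graph) where
  open Graph G using (order; adj; Adj; Vertex)

  Rep : Store → ∀ {m} → Vec Vertex m → Set
  Rep σ         []       = σ 2 ≡ encodeGraph G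
  Rep σ {suc m} (v ∷ vs) = σ (slot m) ≡ tails (toℕ v) (encodeGraph G)
                         × σ (suc (slot m)) ≡ unary (toℕ v)
                         × Rep σ vs

  -- What a program under `m` quantifiers may overwrite: the result, the scratch variable and the
  -- slots of deeper quantifiers. All slots lie above variable 2, so the matrix is safe.
  Unused : ℕ → Var → Set
  Unused m x = x < 2 ⊎ slot m ≤ x

  Unused⇒≢ : ∀ m {x y} → Unused m x → 2 ≤ y → y < slot m → x ≢ y
  Unused⇒≢ m (inj₁ x<2) 2≤y y<  refl = <⇒≱ x<2 2≤y
  Unused⇒≢ m (inj₂ s≤x) 2≤y y<  refl = <⇒≱ y< s≤x

  Rep-↦ : ∀ {σ m x d} (vs : Vec Vertex m) → Unused m x → Rep σ vs → Rep (σ [ x ↦ d ]) vs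
  Rep-↦ {σ} {x = x} {d} [] unused rep = trans (update-other σ {x} d (Unused⇒≢ 0 unused ≤-refl ≤-refl)) rep
  Rep-↦ {σ} {suc m} {x} {d} (v ∷ vs) unused (s≡ , c≡ , rep) =
      trans (update-other σ d (Unused⇒≢ (suc m) unused (<⇒≤ (2<slot m)) (n≤1+n _))) s≡
    , trans (update-other σ d (Unused⇒≢ (suc m) unused (m≤n⇒m≤1+n (<⇒≤ (2<slot m))) ≤-refl)) c≡
    , Rep-↦ vs (Sum.map₂ (≤-trans (m≤n+m _ 2)) unused) rep

  Rep-↦0 : ∀ {σ m d} (vs : Vec Vertex m) → Rep σ vs → Rep (σ [ 0 ↦ d ]) vs
  Rep-↦0 vs = Rep-↦ vs (inj₁ z<s)

  Rep-↦1 : ∀ {σ m d} (vs : Vec Vertex m) → Rep σ vs → Rep (σ [ 1 ↦ d ]) vs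
  Rep-↦1 vs = Rep-↦ vs (inj₁ (s<s z<s))

  Rep-matrix : ∀ {σ m} (vs : Vec Vertex m) → Rep σ vs → σ 2 ≡ encodeGraph G
  Rep-matrix []       rep             = rep
  Rep-matrix (v ∷ vs) (_ , _ , rep) = Rep-matrix vs rep

  Rep-suffix : ∀ {σ m} (vs : Vec Vertex m) i → Rep σ vs →
               σ (slotOf i) ≡ tails (toℕ (lookup vs i)) (encodeGraph G)
  Rep-suffix (v ∷ vs) zero    (s≡ , _ , _)  = s≡
  Rep-suffix (v ∷ vs) (suc i) (_ , _ , rep) = Rep-suffix vs i rep

  Rep-number : ∀ {σ m} (vs : Vec Vertex m) i → Rep σ vs →
               σ (suc (slotOf i)) ≡ unary (toℕ (lookup vs i))
  Rep-number (v ∷ vs) zero    (_ , c≡ , _)  = c≡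
  Rep-number (v ∷ vs) (suc i) (_ , _ , rep) = Rep-number vs i rep

  store : ∀ {m} → Vec Vertex m → Store
  store         []       = (λ _ → nil) [ 2 ↦ encodeGraph G ]
  store {suc m} (v ∷ vs) =
    (store vs [ slot m ↦ tails (toℕ v) (encodeGraph G) ]) [ suc (slot m) ↦ unary (toℕ v) ]

  Rep-store : ∀ {m} (vs : Vec Vertex m) → Rep (store vs) vs
  Rep-store         []       = refl
  Rep-store {suc m} (v ∷ vs) =
      trans (update-other (store vs [ slot m ↦ _ ]) _ 1+n≢n) (update-same (store vs) (slot m) _)
    , update-same _ (suc (slot m)) _
    , Rep-↦ vs (inj₂ (n≤1+n _)) (Rep-↦ vs (inj₂ ≤-refl) (Rep-store vs))

  Answers : ∀ {m} → Vec Vertex m → Set → Store → Set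
  Answers vs P σ = Rep σ vs × (P ⇔ σ 0 ≢ nil)

Predicate : ℕ → Set₁
Predicate m = (G : Graph) → Vec (Graph.Vertex G) m → Set

-- The program depends on the formula alone, and the time bound on the size of the input alone. It
-- must work from every store that represents `vs` and leave such a store behind, because
-- quantifiers run it repeatedly inside loops.
record Definable (m : ℕ) (P : Predicate m) : Set where
  field
    program    : Program
    time       : ℕ → ℕ
    polynomial : Polynomial time
    correct    : ∀ G vs {σ} → Rep G σ vs →
                 Halts program σ (time (size (encodeGraph G))) (Answers G vs (P G vs))

open Definable

-- Running the program settles the predicate. This supplies the case distinctions behind `∀ᵈ` and
-- behind the choice of a largest induced matching.
definable⇒dec : ∀ {m P} → Definable m P → ∀ G vs → Dec (P G vs)
definable⇒dec D G vs with correct D G vs (Rep-store G vs)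
... | σ , _ , _ , _ , _ , P⇔ with nil? (σ 0)
...   | inj₁ σ0≡nil = no λ p → to P⇔ p σ0≡nil
...   | inj₂ σ0≢nil = yes (from P⇔ σ0≢nil)

definable-resp : ∀ {m P Q} → (∀ G vs → P G vs ⇔ Q G vs) → Definable m P → Definable m Q
definable-resp P⇔Q D = record
  { program    = program D
  ; time       = time D
  ; polynomial = polynomial D
  ; correct    = λ G vs rep → relax ≤-refl
      (λ (rep′ , P⇔) → rep′ , mk⇔ (to P⇔ ∘ from (P⇔Q G vs)) (to (P⇔Q G vs) ∘ from P⇔))
      (correct D G vs rep)
  }

⊤ᵈ : ∀ {m} → Definable m (λ _ _ → ⊤)
⊤ᵈ = record
  { program    = 0 := trueᵉ
  ; time       = λ _ → 4
  ; polynomial = poly-const 4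
  ; correct    = λ G vs rep → assigns (Rep-↦0 G vs rep , mk⇔ (λ _ ()) _)
  }

⊥ᵈ : ∀ {m} → Definable m (λ _ _ → ⊥)
⊥ᵈ = record
  { program    = 0 := nilᵉ
  ; time       = λ _ → 2
  ; polynomial = poly-const 2
  ; correct    = λ G vs rep → assigns (Rep-↦0 G vs rep , mk⇔ ⊥-elim λ ≢nil → ≢nil refl)
  }

-- The connectives below are all instances of this conditional. The bound adds the times of both
-- branches, which keeps it polynomial by `poly-+`.
branch : ∀ {m P Q R S} → Definable m P → Definable m Q → Definable m R →
         (∀ {G vs} → P G vs → Q G vs ⇔ S G vs) → (∀ {G vs} → ¬ P G vs → R G vs ⇔ S G vs) →
         Definable m S
branch {P = P} {S = S} DP DQ DR P⇒ ¬P⇒ = record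
  { program    = program DP ⨾ if var 0 then program DQ else program DR
  ; time       = λ n → time DP n + (2 + (time DQ n + time DR n))
  ; polynomial = poly-+ (polynomial DP) (poly-+ (poly-const 2)
                   (poly-+ (polynomial DQ) (polynomial DR)))
  ; correct    = λ G vs rep → correct DP G vs rep ⨟ λ σ (rep′ , P⇔) →
      case nil? (σ 0) of λ where
        (inj₁ σ0≡nil) →
          let σ′ , t , R⇓ , t≤ , rep″ , R⇔ = correct DR G vs rep′
              R⇔S = ¬P⇒ (λ p → to P⇔ p σ0≡nil)
          in  σ′ , 2 + t , if-false σ0≡nil R⇓ , +-monoʳ-≤ 2 (≤-trans t≤ (m≤n+m _ _))
            , rep″ , mk⇔ (to R⇔ ∘ from R⇔S) (to R⇔S ∘ from R⇔)
        (inj₂ σ0≢nil) →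
          let σ′ , t , Q⇓ , t≤ , rep″ , Q⇔ = correct DQ G vs rep′
              Q⇔S = P⇒ (from P⇔ σ0≢nil)
          in  σ′ , 2 + t , if-true σ0≢nil Q⇓ , +-monoʳ-≤ 2 (≤-trans t≤ (m≤m+n _ _))
            , rep″ , mk⇔ (to Q⇔ ∘ from Q⇔S) (to Q⇔S ∘ from Q⇔)
  }

walk : Program
walk = while var 1 loop (0 := tl (var 0) ⨾ 1 := tl (var 1))

-- A round costs 8: 2 for the test and 3 for each assignment. The final, failing test costs 2.
walk-halts : ∀ G {m} (vs : Vec _ m) k {σ d} → σ 0 ≡ d → σ 1 ≡ unary k → Rep G σ vs →
             Halts walk σ (k * 8 + 2) (λ σ′ → σ′ 0 ≡ tails k d × Rep G σ′ vs)
walk-halts G vs zero    {σ} σ0≡ σ1≡ rep = σ , 2 , while-false σ1≡ , ≤-refl , σ0≡ , rep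
walk-halts G vs (suc k) {σ} σ0≡ σ1≡ rep =
  let σ′ , t , w⇓ , t≤ , post = walk-halts G vs k
        (cong tail σ0≡) (cong tail σ1≡) (Rep-↦1 G vs (Rep-↦0 G vs rep))
  in  σ′ , 8 + t , while-true (λ σ1≡nil → case trans (sym σ1≡) σ1≡nil of λ ()) (seq assign assign) w⇓
    , +-monoʳ-≤ 8 t≤ , post

-- The list given by `e` is a row of the matrix in `adjᵈ` and a unary numeral in `<ᵈ`. The number of
-- the vertex is copied to the scratch variable because `walk` consumes it.
entry : ∀ {m} → Expr → Fin m → Program
entry e i = 0 := e ⨾ 1 := var (suc (slotOf i)) ⨾ walk ⨾ 0 := hd (var 0)

entryTime : Expr → ℕ → ℕ
entryTime e n = (1 + cost e) + (2 + ((n * 8 + 2) + 3))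

entryTime-polynomial : ∀ e → Polynomial (entryTime e)
entryTime-polynomial e =
  poly-+ (poly-const (1 + cost e)) (poly-+ (poly-const 2)
    (poly-+ (poly-+ (poly-* poly-id (poly-const 8)) (poly-const 2)) (poly-const 3)))

entry-halts : ∀ G {m} (vs : Vec _ m) e i {σ P} → Rep G σ vs →
  (P ⇔ head (tails (toℕ (lookup vs i)) (eval e σ)) ≢ nil) →
  Halts (entry e i) σ (entryTime e (size (encodeGraph G))) (Answers G vs P)
entry-halts G {m} vs e i {σ} {P} rep P⇔ =
  assigns {Q = λ σ′ → Rep G σ′ vs × σ′ 0 ≡ eval e σ} (Rep-↦0 G vs rep , refl) ⨟ λ σ₁ (rep₁ , σ₁0≡) →
  assigns {Q = λ σ′ → Rep G σ′ vs × σ′ 0 ≡ eval e σ × σ′ 1 ≡ unary (toℕ (lookup vs i))}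
    (Rep-↦1 G vs rep₁ , σ₁0≡ , Rep-number G vs i rep₁) ⨟ λ σ₂ (rep₂ , σ₂0≡ , σ₂1≡) →
  relax (+-monoˡ-≤ 2 (*-monoˡ-≤ 8 (≤-trans (<⇒≤ (Fin.toℕ<n (lookup vs i))) (order≤size G)))) id
    (walk-halts G vs (toℕ (lookup vs i)) σ₂0≡ σ₂1≡ rep₂) ⨟ λ σ₃ (σ₃0≡ , rep₃) →
  assigns (Rep-↦0 G vs rep₃ , subst (λ d → P ⇔ head d ≢ nil) (sym σ₃0≡) P⇔)

adjᵈ : ∀ {m} (i j : Fin m) → Definable m (λ G vs → Graph.Adj G (lookup vs i) (lookup vs j))
adjᵈ i j = record
  { program    = entry (hd (var (slotOf i))) j
  ; time       = entryTime (hd (var (slotOf i)))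
  ; polynomial = entryTime-polynomial (hd (var (slotOf i)))
  ; correct    = λ G vs {σ} rep → entry-halts G vs (hd (var (slotOf i))) j rep
      (let row≡ : head (tails (toℕ (lookup vs j)) (head (σ (slotOf i))))
                  ≡ encodeBool (Graph.adj G (lookup vs i) (lookup vs j))
           row≡ = trans (cong (head ∘ tails (toℕ (lookup vs j)))
                          (trans (cong head (Rep-suffix G vs i rep)) (head-tails-encode _ id (lookup vs i))))
                        (head-tails-encode _ id (lookup vs j))
       in  subst (λ d → Graph.Adj G (lookup vs i) (lookup vs j) ⇔ d ≢ nil) (sym row≡)
                 (mk⇔ (from encodeBool≢nil) (to encodeBool≢nil)))
  }

<ᵈ : ∀ {m} (i j : Fin m) → Definable m (λ G vs → lookup vs i Fin.< lookup vs j)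
<ᵈ i j = record
  { program    = entry (var (suc (slotOf j))) i
  ; time       = entryTime (var (suc (slotOf j)))
  ; polynomial = entryTime-polynomial (var (suc (slotOf j)))
  ; correct    = λ G vs rep → entry-halts G vs (var (suc (slotOf j))) i rep
      (subst (λ d → lookup vs i Fin.< lookup vs j ⇔ head (tails (toℕ (lookup vs i)) d) ≢ nil)
             (sym (Rep-number G vs j rep))
             (let e = head-tails-unary (toℕ (lookup vs i)) (toℕ (lookup vs j)) in mk⇔ (from e) (to e)))
  }

-- Existential quantification by a loop over the vertices

module _ {m} {P : Predicate (suc m)} (D : Definable (suc m) P) where

  -- The language has no exit from a loop. A witness ends the search by emptying the list of
  -- remaining rows, and the positive answer stays in variable 0.
  searchBody : Program
  searchBody = program D ⨾
    (if var 0 then slot m := nilᵉ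
     else (slot m := tl (var (slot m)) ⨾ suc (slot m) := consᵉ trueᵉ (var (suc (slot m)))))

  search : Program
  search = while var (slot m) loop searchBody

  -- A round costs 2 for the loop test, the time of `D`, and at most 11 more: 2 for the conditional,
  -- 3 to advance the rows and 6 to advance the counter.
  searchTime : ℕ → ℕ → ℕ
  searchTime n r = r * (2 + (time D n + 11)) + 2

  -- Induction on the number `r` of vertices still to be tested, `i` being the next. Variable 0 is
  -- nil on entry because, when no vertex is left, the loop stops at once and that value is the
  -- answer.
  search-halts : ∀ G vs r i → i + r ≡ Graph.order G → ∀ {σ} →
    σ (slot m) ≡ tails i (encodeGraph G) → σ (suc (slot m)) ≡ unary i → σ 0 ≡ nil → Rep G σ vs →
    Halts search σ (searchTime (size (encodeGraph G)) r)
      (Answers G vs (∃[ v ] i ≤ toℕ v × P G (v ∷ vs)))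
  search-halts G vs zero i i+0≡n {σ} s≡ c≡ σ0≡ rep =
    σ , 2 , while-false (trans s≡ all-read) , ≤-refl , rep ,
    mk⇔ (λ (v , i≤v , _) → contradiction (Fin.toℕ<n v) (≤⇒≯ (subst (_≤ toℕ v) i≡n i≤v)))
        (contradiction σ0≡)
    where
    i≡n : i ≡ Graph.order G
    i≡n = trans (sym (+-identityʳ i)) i+0≡n
    all-read : tails i (encodeGraph G) ≡ nil
    all-read = subst (λ j → tails j (encodeGraph G) ≡ nil) (sym i≡n) (tails-encode≡nil (row G) id)
  search-halts G vs (suc r) i i+1+r≡n {σ} s≡ c≡ σ0≡ rep
    = continue (correct D G (v ∷ vs)
        ( trans s≡ (cong (λ j → tails j (encodeGraph G)) (sym v≡i))
        , trans c≡ (cong unary (sym v≡i)) , rep))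
    where
    N = size (encodeGraph G)
    i<n : i < Graph.order G
    i<n = subst (i <_) i+1+r≡n (m<m+n i z<s)
    v : Graph.Vertex G
    v = fromℕ< i<n
    v≡i : toℕ v ≡ i
    v≡i = Fin.toℕ-fromℕ< i<n
    nonempty : σ (slot m) ≢ nil
    nonempty s≡nil = tails-encode≢nil (row G) id v
      (trans (cong (λ j → tails j (encodeGraph G)) v≡i) (trans (sym s≡) s≡nil))
    n≢slot : ∀ {x} → x < 2 → slot m ≢ x
    n≢slot x<2 refl = <⇒≱ x<2 (<⇒≤ (2<slot m))
    continue : Halts (program D) σ (time D N) (Answers G (v ∷ vs) (P G (v ∷ vs))) →
               Halts search σ (searchTime N (suc r)) (Answers G vs (∃[ v ] i ≤ toℕ v × P G (v ∷ vs)))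
    continue (σ₁ , t₁ , D⇓ , t₁≤ , (s₁≡ , c₁≡ , rep₁) , P⇔) = go (nil? (σ₁ 0))
      where
      go : σ₁ 0 ≡ nil ⊎ σ₁ 0 ≢ nil → Halts search σ (searchTime N (suc r))
             (Answers G vs (∃[ v ] i ≤ toℕ v × P G (v ∷ vs)))
      go (inj₂ found) =
        σ₁ [ slot m ↦ nil ] , _ ,
        while-true nonempty (seq D⇓ (if-true found assign)) (while-false (update-same σ₁ (slot m) nil)) ,
        (begin
          2 + (t₁ + 4) + 2                ≤⟨ +-monoˡ-≤ 2 (+-monoʳ-≤ 2 (+-mono-≤ t₁≤ (m≤m+n 4 7))) ⟩
          2 + (time D N + 11) + 2         ≤⟨ +-monoˡ-≤ 2 (m≤m+n (2 + (time D N + 11)) _) ⟩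
          searchTime N (suc r)            ∎) ,
        Rep-↦ G vs (inj₂ ≤-refl) rep₁ ,
        mk⇔ (λ _ → subst (_≢ nil) (sym (update-other σ₁ nil (n≢slot z<s))) found)
            (λ _ → v , ≤-reflexive (sym v≡i) , from P⇔ found)
        where open ≤-Reasoning
      go (inj₁ fails) =
        let σ₂ = σ₁ [ slot m ↦ tail (σ₁ (slot m)) ]
            σ₃ = σ₂ [ suc (slot m) ↦ cons (cons nil nil) (σ₂ (suc (slot m))) ]
            σ₄ , t , w⇓ , t≤ , rep₄ , ∃⇔ = search-halts G vs r (suc i)
              (trans (sym (+-suc i r)) i+1+r≡n) {σ₃}
              (trans (update-other σ₂ _ 1+n≢n) (trans (update-same σ₁ (slot m) _)
                (trans (cong tail s₁≡) (trans (tail-tails (toℕ v) _)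
                  (cong (λ j → tails (suc j) (encodeGraph G)) v≡i)))))
              (trans (update-same σ₂ (suc (slot m)) _)
                (cong (cons (cons nil nil)) (trans (update-other σ₁ _ (1+n≢n ∘ sym))
                  (trans c₁≡ (cong unary v≡i)))))
              (trans (update-other σ₂ {suc (slot m)} {0} (cons (cons nil nil) (σ₂ (suc (slot m)))) λ ()) (trans (update-other σ₁ _ (n≢slot z<s)) fails))
              (Rep-↦ G vs (inj₂ (n≤1+n _)) (Rep-↦ G vs (inj₂ ≤-refl) rep₁))
        in σ₄ , _ , while-true nonempty (seq D⇓ (if-false fails (seq assign assign))) w⇓ ,
           (begin
             2 + (t₁ + 11) + t               ≤⟨ +-mono-≤ (+-monoʳ-≤ 2 (+-monoˡ-≤ 11 t₁≤)) t≤ ⟩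
             2 + (time D N + 11) + searchTime N r
               ≡⟨ +-assoc (2 + (time D N + 11)) (r * (2 + (time D N + 11))) 2 ⟨
             searchTime N (suc r)            ∎) ,
           rep₄ ,
           mk⇔ (to ∃⇔ ∘ later) (λ ≢nil → let w , i<w , p = from ∃⇔ ≢nil in w , ≤-trans (n≤1+n i) i<w , p)
        where
        open ≤-Reasoning
        later : ∃[ w ] i ≤ toℕ w × P G (w ∷ vs) → ∃[ w ] suc i ≤ toℕ w × P G (w ∷ vs)
        later (w , i≤w , p) with m≤n⇒m<n∨m≡n i≤w
        ... | inj₁ i<w = w , i<w , p
        ... | inj₂ i≡w = contradiction fails (to P⇔
                (subst (λ u → P G (u ∷ vs)) (Fin.toℕ-injective (trans (sym i≡w) (sym v≡i))) p))

∃ᵈ : ∀ {m P} → Definable (suc m) P → Definable m (λ G vs → ∃[ v ] P G (v ∷ vs))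
∃ᵈ {m} {P} D = record
  { program    = slot m := var 2 ⨾ suc (slot m) := nilᵉ ⨾ 0 := nilᵉ ⨾ search D
  ; time       = λ n → 2 + (2 + (2 + searchTime D n n))
  ; polynomial = poly-+ (poly-const 2) (poly-+ (poly-const 2) (poly-+ (poly-const 2)
                   (poly-+ (poly-* poly-id (poly-+ (poly-const 2) (poly-+ (polynomial D) (poly-const 11))))
                           (poly-const 2))))
  ; correct    = λ G vs {σ} rep →
      assigns {Q = λ σ′ → Rep G σ′ vs × σ′ (slot m) ≡ encodeGraph G}
        (Rep-↦ G vs (inj₂ ≤-refl) rep , trans (update-same σ (slot m) _) (Rep-matrix G vs rep)) ⨟
      λ σ₁ (rep₁ , s₁≡) →
      assigns {Q = λ σ′ → Rep G σ′ vs × σ′ (slot m) ≡ encodeGraph G × σ′ (suc (slot m)) ≡ nil}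
        (Rep-↦ G vs (inj₂ (n≤1+n _)) rep₁ , trans (update-other σ₁ nil 1+n≢n) s₁≡ ,
         update-same σ₁ (suc (slot m)) nil) ⨟
      λ σ₂ (rep₂ , s₂≡ , c₂≡) →
      assigns {Q = λ σ′ → Rep G σ′ vs × σ′ (slot m) ≡ encodeGraph G × σ′ (suc (slot m)) ≡ nil × σ′ 0 ≡ nil}
        (Rep-↦0 G vs rep₂ , trans (update-other σ₂ nil (0≢slot m)) s₂≡ ,
         trans (update-other σ₂ {0} nil λ ()) c₂≡ , refl) ⨟
      λ σ₃ (rep₃ , s₃≡ , c₃≡ , σ₃0≡) →
      relax (+-monoˡ-≤ 2 (*-monoˡ-≤ _ (order≤size G)))
        (λ (rep₄ , ∃⇔) → rep₄ , mk⇔ (λ (v , p) → to ∃⇔ (v , z≤n , p))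
                                    (λ ≢nil → let v , _ , p = from ∃⇔ ≢nil in v , p))
        (search-halts D G vs (Graph.order G) 0 refl s₃≡ c₃≡ σ₃0≡ rep₃)
  }
  where
  0≢slot : ∀ m → 0 ≢ slot m
  0≢slot m 0≡slot = <⇒≱ (2<slot m) (subst (_≤ 2) 0≡slot z≤n)

infixr 7 _×ᵈ_
infixr 6 _⊎ᵈ_
infixr 5 _→ᵈ_
infix  8 ¬ᵈ_

_×ᵈ_ : ∀ {m P Q} → Definable m P → Definable m Q → Definable m (λ G vs → P G vs × Q G vs)
DP ×ᵈ DQ = branch DP DQ ⊥ᵈ (λ p → mk⇔ (p ,_) proj₂) (λ ¬p → mk⇔ ⊥-elim (¬p ∘ proj₁))

_⊎ᵈ_ : ∀ {m P Q} → Definable m P → Definable m Q → Definable m (λ G vs → P G vs ⊎ Q G vs)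
DP ⊎ᵈ DQ = branch DP ⊤ᵈ DQ (λ p → mk⇔ (λ _ → inj₁ p) _)
                           (λ ¬p → mk⇔ inj₂ [ (λ p → contradiction p ¬p) , id ]′)

¬ᵈ_ : ∀ {m P} → Definable m P → Definable m (λ G vs → ¬ P G vs)
¬ᵈ D = branch D ⊥ᵈ ⊤ᵈ (λ p → mk⇔ ⊥-elim (λ ¬p → ¬p p)) (λ ¬p → mk⇔ (λ _ → ¬p) _)

_→ᵈ_ : ∀ {m P Q} → Definable m P → Definable m Q → Definable m (λ G vs → P G vs → Q G vs)
DP →ᵈ DQ = branch DP DQ ⊤ᵈ (λ p → mk⇔ (λ q _ → q) (λ f → f p))
                           (λ ¬p → mk⇔ (λ _ p → contradiction p ¬p) _)

-- Absence of a counterexample; the double negation goes away because definable predicates are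
-- decidable.
∀ᵈ : ∀ {m P} → Definable (suc m) P → Definable m (λ G vs → ∀ v → P G (v ∷ vs))
∀ᵈ D = definable-resp
  (λ G vs → mk⇔ (λ ¬∃¬ v → decidable-stable (definable⇒dec D G (v ∷ vs)) (λ ¬p → ¬∃¬ (v , ¬p)))
                (λ ∀p (v , ¬p) → ¬p (∀p v)))
  (¬ᵈ ∃ᵈ (¬ᵈ D))

-- Trees cannot be tested for equality in this language, so equality of vertices is read off from
-- the order of their numbers.
≡ᵈ : ∀ {m} (i j : Fin m) → Definable m (λ G vs → lookup vs i ≡ lookup vs j)
≡ᵈ i j = definable-resp
  (λ G vs → mk⇔ (λ (≮ , ≯) → case Fin.<-cmp (lookup vs i) (lookup vs j) of λ where
                   (tri< lt _ _) → contradiction lt ≮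
                   (tri≈ _ eq _) → eq
                   (tri> _ _ gt) → contradiction gt ≯)
                (λ eq → Fin.<-irrefl eq , Fin.<-irrefl (sym eq)))
  (¬ᵈ <ᵈ i j ×ᵈ ¬ᵈ <ᵈ j i)

module _ {m} {A : Set} {P : A → Predicate m} (D : ∀ x → Definable m (P x)) where

  Allᵈ : ∀ xs → Definable m (λ G vs → All (λ x → P x G vs) xs)
  Allᵈ []       = definable-resp (λ _ _ → mk⇔ (λ _ → []) _) ⊤ᵈ
  Allᵈ (x ∷ xs) = definable-resp (λ _ _ → mk⇔ (λ (p , ps) → p ∷ ps) All.uncons) (D x ×ᵈ Allᵈ xs)

  Anyᵈ : ∀ xs → Definable m (λ G vs → Any (λ x → P x G vs) xs)
  Anyᵈ []       = definable-resp (λ _ _ → mk⇔ ⊥-elim λ ()) ⊥ᵈ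
  Anyᵈ (x ∷ xs) = definable-resp (λ _ _ → mk⇔ Any.fromSum Any.toSum) (D x ⊎ᵈ Anyᵈ xs)

AllPairsᵈ : ∀ {m} {A : Set} {P : A → A → Predicate m} → (∀ x y → Definable m (P x y)) →
            ∀ xs → Definable m (λ G vs → AllPairs (λ x y → P x y G vs) xs)
AllPairsᵈ D []       = definable-resp (λ _ _ → mk⇔ (λ _ → []) _) ⊤ᵈ
AllPairsᵈ D (x ∷ xs) = definable-resp (λ _ _ → mk⇔ (λ (p , ps) → p ∷ ps) AllPairs.uncons)
                                      (Allᵈ (D x) xs ×ᵈ AllPairsᵈ D xs)

∃ᵈ* : ∀ {m P} → Definable m P → Definable 0 (λ G _ → ∃[ vs ] P G vs)
∃ᵈ* {zero}  D = definable-resp (λ { _ [] → mk⇔ ([] ,_) λ { ([] , p) → p } }) D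
∃ᵈ* {suc m} D = definable-resp (λ { _ [] → mk⇔ (λ (vs , v , p) → v ∷ vs , p)
                                             λ { (v ∷ vs , p) → vs , v , p } }) (∃ᵈ* (∃ᵈ D))

-- Quantification over lists of edges

Indices : ℕ → Set
Indices m = Fin m × Fin m

pick : ∀ {A : Set} {m} → Vec A m → Indices m → A × A
pick vs (i , j) = lookup vs i , lookup vs j

indices : ∀ k → List (Indices (k * 2))
indices zero    = []
indices (suc k) = (zero , suc zero) ∷ map (λ (i , j) → suc (suc i) , suc (suc j)) (indices k)

length-indices : ∀ k → length (indices k) ≡ k
length-indices zero    = refl
length-indices (suc k) = cong suc (trans (length-map _ (indices k)) (length-indices k))

pick-indices : ∀ {A : Set} (xs : List (A × A)) → ∃[ vs ] map (pick vs) (indices (length xs)) ≡ xs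
pick-indices []             = [] , refl
pick-indices ((x , y) ∷ xs) =
  let vs , eq = pick-indices xs
  in  x ∷ y ∷ vs , cong ((x , y) ∷_) (trans (sym (map-∘ (indices (length xs)))) eq)

ListPredicate : Set₁
ListPredicate = (G : Graph) → List (Graph.EndpointPair G) → Set

DefinableOnLists : ListPredicate → Set
DefinableOnLists Q = ∀ {m} (is : List (Indices m)) → Definable m (λ G vs → Q G (map (pick vs) is))

-- By `pick-indices`, every list of `k` pairs is read off from `k * 2` vertices, so the quantifier
-- over lists becomes a block of vertex quantifiers whose length is fixed by the formula.
∃ᴸ : ∀ {Q} → DefinableOnLists Q → ∀ k →
     Definable 0 (λ G _ → ∃[ M ] length M ≡ k × Q G M)
∃ᴸ {Q} D k = definable-resp
  (λ G _ → mk⇔ (λ (vs , q) → map (pick vs) (indices k)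
                           , trans (length-map _ (indices k)) (length-indices k) , q)
               λ { (M , refl , q) → let vs , eq = pick-indices M in vs , subst (Q G) (sym eq) q })
  (∃ᵈ* (D (indices k)))

-- Separated edges, split matchings and the criterion

module _ (G : Graph) where
  open Graph G

  Separated : EndpointPair → EndpointPair → Set
  Separated (u , v) (x , y) = ¬ Adj u x × ¬ Adj u y × ¬ Adj v x × ¬ Adj v y

  -- The first-order form of an induced matching, by `inducedMatching⇔separatedEdges`.
  SeparatedEdges : List EndpointPair → Set
  SeparatedEdges M = All IsEdge M × AllPairs Separated M

  -- A first-order substitute for disconnectedness: the matching is listed so that no edge of the
  -- graph joins its first `a` edges to the others. It is disconnected when both sides are nonempty.
  SplitMatching : ℕ → List EndpointPair → Set
  SplitMatching a M = Matching M × All (λ e → All (Separated e) (drop a M)) (take a M)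

  HasSeparated : ℕ → Set
  HasSeparated k = ∃[ M ] length M ≡ k × SeparatedEdges M

  HasSplit : ℕ → ℕ → Set
  HasSplit a k = ∃[ M ] length M ≡ k × SplitMatching a M

  Leaf : Vertex → Vertex → Set
  Leaf l s = Adj l s × (∀ w → Adj l w → w ≡ s)

  -- No neighbour of s other than l has a leaf; t = l is covered because a leaf at
  -- l can only be s.
  Pendant : Vertex → Vertex → Set
  Pendant s l = Leaf l s × (∀ t k → Adj s t → Leaf k t → k ≡ s)

  AtPendant : EndpointPair → Set
  AtPendant (x , y) = ∃[ s ] ∃[ l ] (s ≡ x ⊎ s ≡ y) × Pendant s l

  -- `u` and `v` have degree 2. Forbidding leaves at `a` keeps pendant edges away from all three
  -- corners, by `corner-leafless`.
  PendantTriangle : Vertex → Vertex → Vertex → Set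
  PendantTriangle u v a =
    Adj u v × Adj u a × Adj v a ×
    (∀ w → Adj u w → w ≡ v ⊎ w ≡ a) × (∀ w → Adj v w → w ≡ u ⊎ w ≡ a) ×
    (∀ l → ¬ Leaf l a)

  Corner : Vertex → Vertex → Vertex → Vertex → Set
  Corner u v a x = x ≡ u ⊎ x ≡ v ⊎ x ≡ a

  InTriangle : EndpointPair → Set
  InTriangle (x , y) =
    ∃[ u ] ∃[ v ] ∃[ a ] PendantTriangle u v a × Corner u v a x × Corner u v a y

  CameronWalker : Set
  CameronWalker = ∀ x y → Adj x y → AtPendant (x , y) ⊎ InTriangle (x , y)

  -- The cases are a common value 0, the local condition with common value at least 2, and a common
  -- value `2 + j` below `2 + (D + D)`. The value 1 cannot occur, as a nonempty disconnected
  -- matching has two edges. In the last case size `3 + j` alone is excluded, since larger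
  -- disconnected matchings can be shrunk to it; `suc p` is the size of the first side.
  Criterion : ℕ → Set
  Criterion D =
    (∀ u v → ¬ Adj u v) ⊎
    (CameronWalker × HasSeparated 2) ⊎
    Any (λ j → HasSeparated (2 + j) × All (λ p → ¬ HasSplit (suc p) (3 + j)) (upTo (2 + j)))
        (upTo (D + D))

-- First-order formulas for the criterion

isEdgeᵈ : ∀ {m} (i : Indices m) → Definable m (λ G vs → Graph.IsEdge G (pick vs i))
isEdgeᵈ (i , j) = adjᵈ i j

separatedᵈ : ∀ {m} (i j : Indices m) → Definable m (λ G vs → Separated G (pick vs i) (pick vs j))
separatedᵈ (u , v) (x , y) = ¬ᵈ adjᵈ u x ×ᵈ ¬ᵈ adjᵈ u y ×ᵈ ¬ᵈ adjᵈ v x ×ᵈ ¬ᵈ adjᵈ v y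

disjointᵈ : ∀ {m} (i j : Indices m) →
            Definable m (λ G vs → Graph.Disjoint G (pick vs i) (pick vs j))
disjointᵈ (u , v) (x , y) = ¬ᵈ ≡ᵈ u x ×ᵈ ¬ᵈ ≡ᵈ u y ×ᵈ ¬ᵈ ≡ᵈ v x ×ᵈ ¬ᵈ ≡ᵈ v y

separatedEdgesᵈ : DefinableOnLists SeparatedEdges
separatedEdgesᵈ is = definable-resp
  (λ G vs → mk⇔ (λ (e , s) → All.map⁺ e , AllPairs.map⁺ s) (λ (e , s) → All.map⁻ e , AllPairs.map⁻ s))
  (Allᵈ isEdgeᵈ is ×ᵈ AllPairsᵈ separatedᵈ is)

matchingᵈ : DefinableOnLists Graph.Matching
matchingᵈ is = definable-resp
  (λ G vs → mk⇔ (λ (e , d) → All.map⁺ e , AllPairs.map⁺ d) (λ (e , d) → All.map⁻ e , AllPairs.map⁻ d))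
  (Allᵈ isEdgeᵈ is ×ᵈ AllPairsᵈ disjointᵈ is)

splitMatchingᵈ : ∀ a → DefinableOnLists (λ G → SplitMatching G a)
splitMatchingᵈ a is = matchingᵈ is ×ᵈ definable-resp
  (λ G vs → mk⇔
    (λ s → subst₂ (λ A B → All (λ e → All (Separated G e) B) A)
             (sym (take-map a is)) (sym (drop-map a is)) (All.map⁺ (All.map All.map⁺ s)))
    (λ s → All.map All.map⁻ (All.map⁻ (subst₂ (λ A B → All (λ e → All (Separated G e) B) A)
             (take-map a is) (drop-map a is) s))))
  (Allᵈ (λ i → Allᵈ (separatedᵈ i) (drop a is)) (take a is))

leafᵈ : ∀ {m} (l s : Fin m) → Definable m (λ G vs → Leaf G (lookup vs l) (lookup vs s))
leafᵈ l s = adjᵈ l s ×ᵈ ∀ᵈ (adjᵈ (suc l) zero →ᵈ ≡ᵈ zero (suc s))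

pendantᵈ : ∀ {m} (s l : Fin m) → Definable m (λ G vs → Pendant G (lookup vs s) (lookup vs l))
pendantᵈ s l = leafᵈ l s ×ᵈ
  ∀ᵈ (∀ᵈ (adjᵈ (suc (suc s)) (suc zero) →ᵈ leafᵈ zero (suc zero) →ᵈ ≡ᵈ zero (suc (suc s))))

pendantTriangleᵈ : ∀ {m} (u v a : Fin m) →
  Definable m (λ G vs → PendantTriangle G (lookup vs u) (lookup vs v) (lookup vs a))
pendantTriangleᵈ u v a =
  adjᵈ u v ×ᵈ adjᵈ u a ×ᵈ adjᵈ v a ×ᵈ
  ∀ᵈ (adjᵈ (suc u) zero →ᵈ ≡ᵈ zero (suc v) ⊎ᵈ ≡ᵈ zero (suc a)) ×ᵈ
  ∀ᵈ (adjᵈ (suc v) zero →ᵈ ≡ᵈ zero (suc u) ⊎ᵈ ≡ᵈ zero (suc a)) ×ᵈ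
  ∀ᵈ (¬ᵈ leafᵈ zero (suc a))

cornerᵈ : ∀ {m} (u v a x : Fin m) →
  Definable m (λ G vs → Corner G (lookup vs u) (lookup vs v) (lookup vs a) (lookup vs x))
cornerᵈ u v a x = ≡ᵈ x u ⊎ᵈ ≡ᵈ x v ⊎ᵈ ≡ᵈ x a

cameronWalkerᵈ : Definable 0 (λ G _ → CameronWalker G)
cameronWalkerᵈ = ∀ᵈ (∀ᵈ (adjᵈ x y →ᵈ
  ∃ᵈ (∃ᵈ ((≡ᵈ (suc zero) (suc (suc x)) ⊎ᵈ ≡ᵈ (suc zero) (suc (suc y))) ×ᵈ pendantᵈ (suc zero) zero)) ⊎ᵈ
  ∃ᵈ (∃ᵈ (∃ᵈ (pendantTriangleᵈ u v a ×ᵈ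
    cornerᵈ u v a (suc (suc (suc x))) ×ᵈ cornerᵈ u v a (suc (suc (suc y))))))))
  where
  x y : Fin 2
  x = suc zero
  y = zero
  u v a : Fin 5
  u = suc (suc zero)
  v = suc zero
  a = zero

hasSeparatedᵈ : ∀ k → Definable 0 (λ G _ → HasSeparated G k)
hasSeparatedᵈ = ∃ᴸ separatedEdgesᵈ

hasSplitᵈ : ∀ a k → Definable 0 (λ G _ → HasSplit G a k)
hasSplitᵈ a = ∃ᴸ (splitMatchingᵈ a)

criterionᵈ : ∀ D → Definable 0 (λ G _ → Criterion G D)
criterionᵈ D =
  ∀ᵈ (∀ᵈ (¬ᵈ adjᵈ (suc zero) zero)) ⊎ᵈ
  (cameronWalkerᵈ ×ᵈ hasSeparatedᵈ 2) ⊎ᵈ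
  Anyᵈ (λ j → hasSeparatedᵈ (2 + j) ×ᵈ Allᵈ (λ p → ¬ᵈ hasSplitᵈ (suc p) (3 + j)) (upTo (2 + j)))
       (upTo (D + D))

-- The input is first copied to variable 2, where `Rep` expects the matrix; this accounts for the
-- extra 2 units of time.
definable⇒polynomialTime : ∀ {P Promise Yes : Graph → Set} → Definable 0 (λ G _ → P G) →
  (∀ G → Promise G → Yes G ⇔ P G) → PolynomialTimeDecidable encodeGraph Promise Yes
definable⇒polynomialTime D Yes⇔P =
  let c , k , T≤ = poly-+ (poly-const 2) (Definable.polynomial D)
  in  (2 := var 0 ⨾ Definable.program D) , c , k , λ G promise →
      let σ , t , p⇓ , t≤T , _ , P⇔ = assigns {Q = λ σ → Rep G σ []} refl ⨟
            λ σ rep → Definable.correct D G [] rep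
          Y⇔P = Yes⇔P G promise
      in  σ , t , p⇓ , ≤-trans t≤T (T≤ (size (encodeGraph G)) {{size-nonZero (encodeGraph G)}}) ,
          mk⇔ (to P⇔ ∘ to Y⇔P) (from Y⇔P ∘ from P⇔)

-- Matchings

AllPairs-resp-↭ : ∀ {A : Set} {R : A → A → Set} {xs ys} → Symmetric R → xs ↭ ys →
                  AllPairs R xs → AllPairs R ys
AllPairs-resp-↭ {A} {R} R-sym xs↭ys =
  Permutation.AllPairs-resp-↭ (setoid A) R-sym (resp₂ R) (↭⇒↭ₛ xs↭ys)

AllPairs-map-∈ : ∀ {A : Set} {R S : A → A → Set} {xs} →
                 (∀ {x y} → x List.∈ xs → y List.∈ xs → R x y → S x y) →
                 AllPairs R xs → AllPairs S xs
AllPairs-map-∈ f []          = []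
AllPairs-map-∈ f (rs ∷ rss) =
  All.tabulate (λ y∈xs → f (here refl) (there y∈xs) (All.lookup rs y∈xs)) ∷
  AllPairs-map-∈ (λ x∈xs y∈xs → f (there x∈xs) (there y∈xs)) rss

AllPairs-++⁻ : ∀ {A : Set} {R : A → A → Set} xs {ys} → AllPairs R (xs ++ ys) →
               AllPairs R xs × AllPairs R ys × All (λ x → All (R x) ys) xs
AllPairs-++⁻ []       rss        = [] , rss , []
AllPairs-++⁻ (x ∷ xs) (rs ∷ rss) =
  let rsˡ , rsʳ = All.++⁻ xs rs
      rssˡ , rssʳ , cross = AllPairs-++⁻ xs rss
  in  rsˡ ∷ rssˡ , rssʳ , rsʳ ∷ cross

∈⇒↭ : ∀ {A : Set} {x : A} {xs} → x List.∈ xs → ∃[ ys ] xs ↭ x ∷ ys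
∈⇒↭ x∈xs with ys , zs , refl ← ∈-∃++ x∈xs = ys ++ zs , shift _ ys zs

take-length-++ : ∀ {A : Set} (xs ys : List A) → take (length xs) (xs ++ ys) ≡ xs
take-length-++ []       ys = refl
take-length-++ (x ∷ xs) ys = cong (x ∷_) (take-length-++ xs ys)

drop-length-++ : ∀ {A : Set} (xs ys : List A) → drop (length xs) (xs ++ ys) ≡ ys
drop-length-++ []       ys = refl
drop-length-++ (x ∷ xs) ys = drop-length-++ xs ys

length-take-≤ : ∀ {A : Set} {k} {xs : List A} → k ≤ length xs → length (take k xs) ≡ k
length-take-≤ {k = k} {xs} k≤ = trans (length-take k xs) (m≤n⇒m⊓n≡m k≤)

maximum : ∀ {P : ℕ → Set} → (∀ k → Dec (P k)) → ∀ n {m} → (∀ k → P k → k ≤ n) → P m →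
          ∃[ k ] m ≤ k × P k × (∀ j → P j → j ≤ k)
maximum P? zero    {m} ≤n Pm = m , ≤-refl , Pm , λ j Pj → ≤-trans (≤n j Pj) z≤n
maximum {P} P? (suc n) {m} ≤n Pm with P? (suc n)
... | yes Pn = suc n , ≤n m Pm , Pn , ≤n
... | no ¬Pn = maximum P? n (λ k Pk → s≤s⁻¹ (≤∧≢⇒< (≤n k Pk) λ { refl → ¬Pn Pk })) Pm

∣p∪q∣≤∣p∣+∣q∣ : ∀ {n} (p q : Subset n) → ∣ p ∪ q ∣ ≤ ∣ p ∣ + ∣ q ∣
∣p∪q∣≤∣p∣+∣q∣ []            []            = z≤n
∣p∪q∣≤∣p∣+∣q∣ (outside ∷ p) (outside ∷ q) = ∣p∪q∣≤∣p∣+∣q∣ p q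
∣p∪q∣≤∣p∣+∣q∣ (outside ∷ p) (inside  ∷ q) =
  ≤-trans (s≤s (∣p∪q∣≤∣p∣+∣q∣ p q)) (≤-reflexive (sym (+-suc ∣ p ∣ ∣ q ∣)))
∣p∪q∣≤∣p∣+∣q∣ (inside  ∷ p) (outside ∷ q) = s≤s (∣p∪q∣≤∣p∣+∣q∣ p q)
∣p∪q∣≤∣p∣+∣q∣ (inside  ∷ p) (inside  ∷ q) =
  s≤s (≤-trans (∣p∪q∣≤∣p∣+∣q∣ p q) (+-monoʳ-≤ ∣ p ∣ (n≤1+n ∣ q ∣)))

length≤∣p∣ : ∀ {n xs} (p : Subset n) → AllPairs _≢_ xs → All (_∈ p) xs → length xs ≤ ∣ p ∣
length≤∣p∣ p []           []           = z≤n
length≤∣p∣ p (x≢xs ∷ xs!) (x∈p ∷ xs∈p) = <-≤-trans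
  (s≤s (length≤∣p∣ (p - _) xs!
    (All.zipWith (λ (x≢y , y∈p) → x∈p∧x≢y⇒x∈p-y y∈p (x≢y ∘ sym)) (x≢xs , xs∈p))))
  (x∈p⇒∣p-x∣<∣p∣ x∈p)

-- Induced matchings as lists of separated edges

module _ (G : Graph) where
  open Graph G renaming (sym to adj-sym)

  Adj-sym : ∀ {u v} → Adj u v → Adj v u
  Adj-sym {u} {v} = trans (adj-sym v u)

  Adj-irrefl : ∀ {u} → ¬ Adj u u
  Adj-irrefl {u} u~u = case trans (sym u~u) (irrefl u) of λ ()

  Adj? : ∀ u v → Dec (Adj u v)
  Adj? u v = adj u v Bool.≟ true

  Adj⇒≢ : ∀ {u v} → Adj u v → u ≢ v
  Adj⇒≢ u~v refl = Adj-irrefl u~v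

  neighbours⁺ : ∀ {u v} → Adj u v → v ∈ neighbours u
  neighbours⁺ {u} {v} u~v = lookup⇒[]= v _ (trans (lookup∘tabulate (adj u) v) u~v)

  neighbours⁻ : ∀ {u v} → v ∈ neighbours u → Adj u v
  neighbours⁻ {u} {v} v∈N = trans (sym (lookup∘tabulate (adj u) v)) ([]=⇒lookup v∈N)

  degree≤Δ : ∀ u → degree u ≤ Δ
  degree≤Δ u = All.lookup (xs≤max 0 (map degree (allFin order))) (∈-map⁺ degree (∈-allFin u))

  infix 4 _∈ᵉ_ _∈ᵉ?_

  _∈ᵉ_ : Vertex → EndpointPair → Set
  x ∈ᵉ (u , v) = x ≡ u ⊎ x ≡ v

  _∈ᵉ?_ : ∀ x e → Dec (x ∈ᵉ e)
  x ∈ᵉ? (u , v) = (x Fin.≟ u) ⊎-dec (x Fin.≟ v)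

  V⁺ : ∀ {x M} → Any (x ∈ᵉ_) M → x ∈ V M
  V⁺ (here (inj₁ refl)) = x∈p∪q⁺ (inj₁ (x∈p∪q⁺ (inj₁ (x∈⁅x⁆ _))))
  V⁺ (here (inj₂ refl)) = x∈p∪q⁺ (inj₁ (x∈p∪q⁺ (inj₂ (x∈⁅x⁆ _))))
  V⁺ (there x∈M)        = x∈p∪q⁺ (inj₂ (V⁺ x∈M))

  V⁻ : ∀ {x} M → x ∈ V M → Any (x ∈ᵉ_) M
  V⁻ []      x∈⊥ = contradiction x∈⊥ ∉⊥
  V⁻ (e ∷ M) x∈V with x∈p∪q⁻ (ends e) (V M) x∈V
  ... | inj₂ x∈M = there (V⁻ M x∈M)
  ... | inj₁ x∈e with x∈p∪q⁻ ⁅ proj₁ e ⁆ ⁅ proj₂ e ⁆ x∈e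
  ...   | inj₁ x∈u = here (inj₁ (x∈⁅y⁆⇒x≡y _ x∈u))
  ...   | inj₂ x∈v = here (inj₂ (x∈⁅y⁆⇒x≡y _ x∈v))

  partner : ∀ {x e} → x ∈ᵉ e → IsEdge e →
            ∃[ y ] y ∈ᵉ e × Adj x y × (∀ {z} → z ∈ᵉ e → z ≡ x ⊎ z ≡ y)
  partner (inj₁ refl) u~v = _ , inj₂ refl , u~v , id
  partner (inj₂ refl) u~v = _ , inj₁ refl , Adj-sym u~v , Sum.swap

  disjoint⁻ : ∀ {e f x y} → Disjoint e f → x ∈ᵉ e → y ∈ᵉ f → x ≢ y
  disjoint⁻ (ux , uy , vx , vy) (inj₁ refl) (inj₁ refl) = ux
  disjoint⁻ (ux , uy , vx , vy) (inj₁ refl) (inj₂ refl) = uy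
  disjoint⁻ (ux , uy , vx , vy) (inj₂ refl) (inj₁ refl) = vx
  disjoint⁻ (ux , uy , vx , vy) (inj₂ refl) (inj₂ refl) = vy

  disjoint⁺ : ∀ {e f} → (∀ {x y} → x ∈ᵉ e → y ∈ᵉ f → x ≢ y) → Disjoint e f
  disjoint⁺ f = f (inj₁ refl) (inj₁ refl) , f (inj₁ refl) (inj₂ refl)
              , f (inj₂ refl) (inj₁ refl) , f (inj₂ refl) (inj₂ refl)

  separated⁻ : ∀ {e f x y} → Separated G e f → x ∈ᵉ e → y ∈ᵉ f → ¬ Adj x y
  separated⁻ (ux , uy , vx , vy) (inj₁ refl) (inj₁ refl) = ux
  separated⁻ (ux , uy , vx , vy) (inj₁ refl) (inj₂ refl) = uy
  separated⁻ (ux , uy , vx , vy) (inj₂ refl) (inj₁ refl) = vx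
  separated⁻ (ux , uy , vx , vy) (inj₂ refl) (inj₂ refl) = vy

  separated⁺ : ∀ {e f} → (∀ {x y} → x ∈ᵉ e → y ∈ᵉ f → ¬ Adj x y) → Separated G e f
  separated⁺ f = f (inj₁ refl) (inj₁ refl) , f (inj₁ refl) (inj₂ refl)
               , f (inj₂ refl) (inj₁ refl) , f (inj₂ refl) (inj₂ refl)

  Disjoint-sym : Symmetric Disjoint
  Disjoint-sym e#f = disjoint⁺ λ x∈f y∈e → disjoint⁻ e#f y∈e x∈f ∘ sym

  Separated-sym : Symmetric (Separated G)
  Separated-sym e#f = separated⁺ λ x∈f y∈e → separated⁻ e#f y∈e x∈f ∘ Adj-sym

  -- A common vertex would be adjacent to the other end of `f`.
  separated⇒disjoint : ∀ {e f} → IsEdge f → Separated G e f → Disjoint e f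
  separated⇒disjoint f-edge e#f = disjoint⁺ λ where
    x∈e y∈f refl → let z , z∈f , x~z , _ = partner y∈f f-edge in separated⁻ e#f x∈e z∈f x~z

  linked? : ∀ e f → (∃[ x ] ∃[ y ] x ∈ᵉ e × y ∈ᵉ f × Adj x y) ⊎ Separated G e f
  linked? (u , v) (x , y) with Adj? u x | Adj? u y | Adj? v x | Adj? v y
  ... | yes ux | _      | _      | _      = inj₁ (u , x , inj₁ refl , inj₁ refl , ux)
  ... | no _   | yes uy | _      | _      = inj₁ (u , y , inj₁ refl , inj₂ refl , uy)
  ... | no _   | no _   | yes vx | _      = inj₁ (v , x , inj₂ refl , inj₁ refl , vx)
  ... | no _   | no _   | no _   | yes vy = inj₁ (v , y , inj₂ refl , inj₂ refl , vy)
  ... | no ux  | no uy  | no vx  | no vy  = inj₂ (ux , uy , vx , vy)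

  separatedEdges⇒matching : ∀ {M} → SeparatedEdges G M → Matching M
  separatedEdges⇒matching (edges , sep) =
    edges , AllPairs-map-∈ (λ _ f∈M → separated⇒disjoint (All.lookup edges f∈M)) sep

  adjacent-in : ∀ {M e x y} → SeparatedEdges G M → e List.∈ M → x ∈ᵉ e →
                Any (y ∈ᵉ_) M → Adj x y → y ∈ᵉ e
  adjacent-in (edges , sep) e∈M x∈e y∈M x~y with f , f∈M , y∈f ← find y∈M
    with ∈-AllPairs₂ sep e∈M f∈M
  ... | inj₁ refl       = y∈f
  ... | inj₂ (inj₁ e#f) = contradiction x~y (separated⁻ e#f x∈e y∈f)
  ... | inj₂ (inj₂ f#e) = contradiction (Adj-sym x~y) (separated⁻ f#e y∈f x∈e)

  -- A link between two edges of `M` would give its end `x` a second neighbour in `V M` besides its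
  -- partner. Without links the partner is the only one.
  inducedMatching⇔separatedEdges : ∀ {M} → InducedMatching M ⇔ SeparatedEdges G M
  inducedMatching⇔separatedEdges {M} = mk⇔ separated
    (λ sep → separatedEdges⇒matching sep , inj₁ (regular sep))
    where
    separated : InducedMatching M → SeparatedEdges G M
    separated ((edges , disj) , inj₂ refl) = [] , []
    separated ((edges , disj) , inj₁ reg)  = edges , AllPairs-map-∈ not-linked disj
      where
      not-linked : ∀ {e f} → e List.∈ M → f List.∈ M → Disjoint e f → Separated G e f
      not-linked e∈M f∈M e#f = separated⁺ λ {x} x∈e y∈f x~y →
        let z , z∈e , x~z , _ = partner x∈e (All.lookup edges e∈M)
            x∈M = lose e∈M x∈e
        in  contradiction (reg x (V⁺ x∈M)) (>⇒≢ (length≤∣p∣ (neighbours x ∩ V M)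
              ((disjoint⁻ e#f z∈e y∈f ∷ []) ∷ [] ∷ [])
              (x∈p∩q⁺ (neighbours⁺ x~z , V⁺ (lose e∈M z∈e)) ∷
               x∈p∩q⁺ (neighbours⁺ x~y , V⁺ (lose f∈M y∈f)) ∷ [])))
    regular : SeparatedEdges G M → InducedRegular 1 (V M)
    regular sep x x∈V with e , e∈M , x∈e ← find (V⁻ M x∈V)
      with y , y∈e , x~y , only ← partner x∈e (All.lookup (proj₁ sep) e∈M) =
      trans (cong ∣_∣ (⊆-antisym ⊆y y⊆)) (∣⁅x⁆∣≡1 y)
      where
      ⊆y : ∀ {z} → z ∈ neighbours x ∩ V M → z ∈ ⁅ y ⁆
      ⊆y z∈ with z∈N , z∈V ← x∈p∩q⁻ (neighbours x) (V M) z∈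
        with only (adjacent-in sep e∈M x∈e (V⁻ M z∈V) (neighbours⁻ z∈N))
      ... | inj₁ refl = contradiction (neighbours⁻ z∈N) Adj-irrefl
      ... | inj₂ refl = x∈⁅x⁆ _
      y⊆ : ∀ {z} → z ∈ ⁅ y ⁆ → z ∈ neighbours x ∩ V M
      y⊆ z∈ with refl ← x∈⁅y⁆⇒x≡y y z∈ = x∈p∩q⁺ (neighbours⁺ x~y , V⁺ (lose e∈M y∈e))

  -- Disconnected matchings as split matchings

  AllSeparated : List EndpointPair → List EndpointPair → Set
  AllSeparated A B = All (λ e → All (Separated G e) B) A

  -- A path inside `V M` that starts on the first side can never leave it, so it does not reach `f`.
  split⇒disconnected : ∀ {e f A B} → Matching ((e ∷ A) ++ (f ∷ B)) →
                       AllSeparated (e ∷ A) (f ∷ B) → DisconnectedMatching ((e ∷ A) ++ (f ∷ B))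
  split⇒disconnected {e} {f} {A} {B} matching sep = matching , inj₁ λ connected →
    outside-A (stays (connected (proj₁ e) (proj₁ f) (V⁺ {M = (e ∷ A) ++ (f ∷ B)} (here (inj₁ refl)))
                       (V⁺ (Any.++⁺ʳ (e ∷ A) (here (inj₁ refl)))))
                     (here (inj₁ refl)))
    where
    stays : ∀ {x y} → Star (InducedAdj (V ((e ∷ A) ++ (f ∷ B)))) x y →
            Any (x ∈ᵉ_) (e ∷ A) → Any (y ∈ᵉ_) (e ∷ A)
    stays ε                       x∈A = x∈A
    stays ((_ , z∈V , x~z) ◅ path) x∈A with Any.++⁻ (e ∷ A) (V⁻ ((e ∷ A) ++ (f ∷ B)) z∈V)
    ... | inj₁ z∈A = stays path z∈A
    ... | inj₂ z∈B =
      let g , g∈A , x∈g = find x∈A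
          h , h∈B , z∈h = find z∈B
      in  contradiction x~z (separated⁻ (All.lookup (All.lookup sep g∈A) h∈B) x∈g z∈h)
    -- If `f` shared a vertex with an edge `g` of the first side, then `f` itself would link `g` to
    -- `f`.
    outside-A : ¬ Any (proj₁ f ∈ᵉ_) (e ∷ A)
    outside-A f∈A =
      let g , g∈A , f₁∈g = find f∈A
          f-edge = All.lookup (proj₁ matching) (∈-++⁺ʳ (e ∷ A) (here refl))
      in  separated⁻ (All.lookup (All.lookup sep g∈A) (here refl)) f₁∈g (inj₂ refl) f-edge

  Split : List EndpointPair → Set
  Split M = ∃[ e ] ∃[ A ] ∃[ f ] ∃[ B ] M ↭ (e ∷ A) ++ (f ∷ B) × AllSeparated (e ∷ A) (f ∷ B)

  module _ {M} (edges : All IsEdge M) (r : Vertex) where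

    Reached : EndpointPair → Set
    Reached e = ∀ {x} → x ∈ᵉ e → Star (InducedAdj (V M)) r x

    reach : ∀ {e f x y} → e List.∈ M → f List.∈ M → Reached e →
            x ∈ᵉ e → y ∈ᵉ f → Adj x y → Reached f
    reach e∈M f∈M reached x∈e y∈f x~y z∈f
      with w , w∈f , y~w , only ← partner y∈f (All.lookup edges f∈M) with only z∈f
    ... | inj₁ refl = reached x∈e ◅◅ (V⁺ (lose e∈M x∈e) , V⁺ (lose f∈M y∈f) , x~y) ◅ ε
    ... | inj₂ refl = reached x∈e ◅◅ (V⁺ (lose e∈M x∈e) , V⁺ (lose f∈M y∈f) , x~y)
                                  ◅ (V⁺ (lose f∈M y∈f) , V⁺ (lose f∈M w∈f) , y~w) ◅ ε

    -- The component of r is grown by one edge at a time.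
    grow : ∀ n e A B → length B ≡ n → M ↭ (e ∷ A) ++ B → All Reached (e ∷ A) →
           All Reached M ⊎ Split M
    grow n e A [] _ M↭ reached =
      inj₁ (All-resp-↭ (↭-sym M↭) (All.++⁺ reached []))
    grow (suc n) e A (f ∷ B) len M↭ reached
      with Any.any? (λ h → Any.any? (λ g → ¬? (separated? g h)) (e ∷ A)) (f ∷ B)
      where
      separated? : ∀ g h → Dec (Separated G g h)
      separated? (u , v) (x , y) =
        ¬? (Adj? u x) ×-dec ¬? (Adj? u y) ×-dec ¬? (Adj? v x) ×-dec ¬? (Adj? v y)
    -- Nothing outside is linked to a reached edge, so the reached edges form one side of a split.
    ... | no none = inj₂ (e , A , f , B , M↭ , All.tabulate λ g∈A → All.tabulate λ h∈B →
            case linked? _ _ of λ where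
              (inj₂ g#h) → g#h
              (inj₁ (_ , _ , x∈g , y∈h , x~y)) → contradiction
                (lose h∈B (lose g∈A λ g#h → separated⁻ g#h x∈g y∈h x~y)) none)
    ... | yes some with h , h∈B , some′ ← find some with g , g∈A , ¬g#h ← find some′
      with linked? g h
    ...   | inj₂ g#h = contradiction g#h ¬g#h
    ...   | inj₁ (x , y , x∈g , y∈h , x~y) with B′ , B↭ ← ∈⇒↭ h∈B =
            grow n h (e ∷ A) B′
              (suc-injective (trans (sym (↭-length B↭)) len))
              (↭-trans M↭ (↭-trans (++⁺ˡ (e ∷ A) B↭) (shift h (e ∷ A) B′)))
              (reach (∈-resp-↭ (↭-sym M↭) (∈-++⁺ˡ g∈A)) (∈-resp-↭ (↭-sym M↭) (∈-++⁺ʳ (e ∷ A) h∈B))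
                     (All.lookup reached g∈A) x∈g y∈h x~y ∷ reached)

  disconnected⇒split : ∀ {M} → DisconnectedMatching M → M ≡ [] ⊎ Split M
  disconnected⇒split (_ , inj₂ M≡[]) = inj₁ M≡[]
  disconnected⇒split {[]} (_ , inj₁ _) = inj₁ refl
  disconnected⇒split {e ∷ M} ((u~v ∷ edges , disj) , inj₁ ¬connected)
    with grow (u~v ∷ edges) (proj₁ e) (length M) e [] M refl ↭-refl (start ∷ [])
    where
    start : Reached (u~v ∷ edges) (proj₁ e) e
    start (inj₁ refl) = ε
    start (inj₂ refl) = (V⁺ {M = e ∷ M} (here (inj₁ refl)) , V⁺ {M = e ∷ M} (here (inj₂ refl)) , u~v) ◅ ε
  ... | inj₂ split   = inj₂ split
  ... | inj₁ reached = contradiction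
    (λ u v u∈V v∈V → reverse (λ (x∈ , y∈ , x~y) → y∈ , x∈ , Adj-sym x~y) (path u∈V) ◅◅ path v∈V)
    ¬connected
    where
    path : ∀ {x} → x ∈ V (e ∷ M) → Star (InducedAdj (V (e ∷ M))) (proj₁ e) x
    path x∈V = let f , f∈M , x∈f = find (V⁻ (e ∷ M) x∈V) in All.lookup reached f∈M x∈f

  -- One vertex of `p` is chosen from each edge. Disjointness makes the choices distinct, and for
  -- this `choose` records that they lie on edges of the matching.
  matching-bound : ∀ {M} → AllPairs Disjoint M → (p : Subset order) →
                   All (λ e → ∃[ x ] x ∈ᵉ e × x ∈ p) M → length M ≤ ∣ p ∣
  matching-bound {M} disj p hits =
    let xs , len , xs! , xs∈p , _ = choose disj hits in subst (_≤ ∣ p ∣) len (length≤∣p∣ p xs! xs∈p)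
    where
    choose : ∀ {M} → AllPairs Disjoint M → All (λ e → ∃[ x ] x ∈ᵉ e × x ∈ p) M →
             ∃[ xs ] length xs ≡ length M × AllPairs _≢_ xs × All (_∈ p) xs ×
                     All (λ x → Any (x ∈ᵉ_) M) xs
    choose []             []                       = [] , refl , [] , [] , []
    choose (e#M ∷ disj) ((x , x∈e , x∈p) ∷ hits) =
      let xs , len , xs! , xs∈p , xs∈M = choose disj hits
      in  x ∷ xs , cong suc len ,
          All.map (λ y∈M → let f , f∈M , y∈f = find y∈M in disjoint⁻ (All.lookup e#M f∈M) x∈e y∈f) xs∈M ∷ xs! ,
          x∈p ∷ xs∈p , here x∈e ∷ All.map there xs∈M

  escape : ∀ {M} → AllPairs Disjoint M → (p : Subset order) → ∣ p ∣ < length M →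
           ∃[ e ] e List.∈ M × (∀ {x} → x ∈ᵉ e → x ∉ p)
  escape {M} disj p small
    with Any.any? (λ (u , v) → ¬? (u ∈? p) ×-dec ¬? (v ∈? p)) M
  ... | yes some = let e , e∈M , u∉p , v∉p = find some
                   in  e , e∈M , λ { (inj₁ refl) → u∉p ; (inj₂ refl) → v∉p }
  ... | no none  = contradiction (matching-bound disj p (All.map hit (All.¬Any⇒All¬ M none))) (<⇒≱ small)
    where
    hit : ∀ {e} → ¬ (proj₁ e ∉ p × proj₂ e ∉ p) → ∃[ x ] x ∈ᵉ e × x ∈ p
    hit {u , v} ¬both with u ∈? p
    ... | yes u∈p = u , inj₁ refl , u∈p
    ... | no  u∉p = v , inj₂ refl , decidable-stable (v ∈? p) (λ v∉p → ¬both (u∉p , v∉p))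

  -- From the local condition to induced matchings

  pendantTriangle-sym : ∀ {u v a} → PendantTriangle G u v a → PendantTriangle G v u a
  pendantTriangle-sym (uv , ua , va , Nu , Nv , ¬leaf) = Adj-sym uv , va , ua , Nv , Nu , ¬leaf

  corner-sym : ∀ {u v a x} → Corner G u v a x → Corner G v u a x
  corner-sym (inj₁ x≡u)        = inj₂ (inj₁ x≡u)
  corner-sym (inj₂ (inj₁ x≡v)) = inj₁ x≡v
  corner-sym (inj₂ (inj₂ x≡a)) = inj₂ (inj₂ x≡a)

  -- A leaf at `u` would be `v` or `a`, but these are adjacent to each other as well as to `u`. The
  -- corner `v` is symmetric, and `a` is covered by definition.
  corner-leafless : ∀ {u v a} → PendantTriangle G u v a → ∀ {c l} → Corner G u v a c → ¬ Leaf G l c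
  corner-leafless (_ , _ , _ , _ , _ , ¬leaf) (inj₂ (inj₂ refl)) leaf = ¬leaf _ leaf
  corner-leafless tri (inj₂ (inj₁ refl)) leaf =
    corner-leafless (pendantTriangle-sym tri) (inj₁ refl) leaf
  corner-leafless (uv , ua , va , Nu , Nv , _) (inj₁ refl) (l~u , only-u)
    with Nu _ (Adj-sym l~u)
  ... | inj₁ refl = Adj⇒≢ ua (sym (only-u _ va))
  ... | inj₂ refl = Adj⇒≢ uv (sym (only-u _ (Adj-sym va)))

  corner-nbr : ∀ {u v a} → PendantTriangle G u v a → ∀ {w} → Adj u w → Corner G u v a w
  corner-nbr (_ , _ , _ , Nu , _) u~w = inj₂ (Nu _ u~w)

  -- Two disjoint edges have four ends, and a triangle has three corners.
  same-triangle : ∀ {u v a e f} → IsEdge e → IsEdge f → Disjoint e f →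
                  (∀ {x} → x ∈ᵉ e → Corner G u v a x) →
                  (∀ {x} → x ∈ᵉ f → Corner G u v a x) → ⊥
  same-triangle {u} {v} {a} e-edge f-edge (ux , uy , vx , vy) e⊆ f⊆ = contradiction
    (≤-trans (length≤∣p∣ triangle
        ((Adj⇒≢ e-edge ∷ ux ∷ uy ∷ []) ∷ (vx ∷ vy ∷ []) ∷ (Adj⇒≢ f-edge ∷ []) ∷ [] ∷ [])
        (member (e⊆ (inj₁ refl)) ∷ member (e⊆ (inj₂ refl)) ∷
         member (f⊆ (inj₁ refl)) ∷ member (f⊆ (inj₂ refl)) ∷ []))
      size≤3)
    (<⇒≱ ≤-refl)
    where
    triangle : Subset order
    triangle = ⁅ u ⁆ ∪ (⁅ v ⁆ ∪ ⁅ a ⁆)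
    member : ∀ {x} → Corner G u v a x → x ∈ triangle
    member (inj₁ refl)        = x∈p∪q⁺ (inj₁ (x∈⁅x⁆ u))
    member (inj₂ (inj₁ refl)) = x∈p∪q⁺ (inj₂ (x∈p∪q⁺ (inj₁ (x∈⁅x⁆ v))))
    member (inj₂ (inj₂ refl)) = x∈p∪q⁺ (inj₂ (x∈p∪q⁺ (inj₂ (x∈⁅x⁆ a))))
    size≤3 : ∣ triangle ∣ ≤ 3
    size≤3 = ≤-trans (∣p∪q∣≤∣p∣+∣q∣ ⁅ u ⁆ (⁅ v ⁆ ∪ ⁅ a ⁆))
      (+-mono-≤ (≤-reflexive (∣⁅x⁆∣≡1 u))
        (≤-trans (∣p∪q∣≤∣p∣+∣q∣ ⁅ v ⁆ ⁅ a ⁆)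
          (+-mono-≤ (≤-reflexive (∣⁅x⁆∣≡1 v)) (≤-reflexive (∣⁅x⁆∣≡1 a)))))

  -- The neighbour `u′` of `u` is `v` or `a`. If it is `v`, its neighbours `v′` and `a′` are corners
  -- of the first triangle. If it is `a`, then `u` and `v` are its two neighbours, so they are `v′`
  -- and `a′`.
  linked-triangles : ∀ {u v a u′ v′ a′} → PendantTriangle G u v a → PendantTriangle G u′ v′ a′ →
                     Adj u u′ → ∀ {x} → Corner G u′ v′ a′ x → Corner G u v a x
  linked-triangles (uv , ua , va , Nu , Nv , _) (uv′ , ua′ , va′ , Nu′ , Nv′ , _) u~u′ x
    with Nu _ u~u′ | x
  ... | inj₁ refl | inj₁ refl = inj₂ (inj₁ refl)
  ... | inj₁ refl | inj₂ (inj₁ refl) = Sum.map₂ inj₂ (Nv _ uv′)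
  ... | inj₁ refl | inj₂ (inj₂ refl) = Sum.map₂ inj₂ (Nv _ ua′)
  ... | inj₂ refl | inj₁ refl = inj₂ (inj₂ refl)
  ... | inj₂ refl | inj₂ x′ with Nu′ _ (Adj-sym ua) | Nu′ _ (Adj-sym va)
  ...   | inj₁ refl | inj₁ refl = contradiction uv Adj-irrefl
  ...   | inj₂ refl | inj₂ refl = contradiction uv Adj-irrefl
  ...   | inj₁ refl | inj₂ refl = Sum.map₂ inj₁ x′
  ...   | inj₂ refl | inj₁ refl = Sum.map₂ inj₁ (Sum.swap x′)

  -- The edge that replaces a given edge of a matching when the matching is
  -- turned into an induced one of the same size.
  data Replacement (e : EndpointPair) : EndpointPair → Set where
    pendant  : ∀ {s l} → s ∈ᵉ e → Pendant G s l → Replacement e (s , l)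
    triangle : ∀ {u v a} → (∀ {x} → x ∈ᵉ e → Corner G u v a x) →
               PendantTriangle G u v a → Replacement e (u , v)

  replace : CameronWalker G → ∀ {e} → IsEdge e → ∃[ g ] Replacement e g
  replace cw x~y with cw _ _ x~y
  ... | inj₁ (s , l , s∈e , pend) = (s , l) , pendant s∈e pend
  ... | inj₂ (u , v , a , tri , x , y) =
        (u , v) , triangle (λ { (inj₁ refl) → x ; (inj₂ refl) → y }) tri

  replacement-edge : ∀ {e g} → Replacement e g → IsEdge g
  replacement-edge (pendant _ ((l~s , _) , _)) = Adj-sym l~s
  replacement-edge (triangle _ (uv , _))       = uv

  -- A link would make `s` a corner of the triangle, and corners have no leaves.
  pendant-triangle-separated : ∀ {s l u v a} → Pendant G s l → PendantTriangle G u v a →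
                               Separated G (s , l) (u , v)
  pendant-triangle-separated {s} {l} {u} {v} {a} ((l~s , only-s) , _) tri =
    not-s tri , not-s (pendantTriangle-sym tri) , not-l tri , not-l (pendantTriangle-sym tri)
    where
    not-s : ∀ {u v} → PendantTriangle G u v a → ¬ Adj s u
    not-s tri s~u = corner-leafless tri (corner-nbr tri (Adj-sym s~u)) (l~s , only-s)
    not-l : ∀ {u v} → PendantTriangle G u v a → ¬ Adj l u
    not-l tri l~u with refl ← only-s _ l~u = corner-leafless tri (inj₁ refl) (l~s , only-s)

  replacement-separated : ∀ {e f g h} → IsEdge e → IsEdge f → Disjoint e f →
                          Replacement e g → Replacement f h → Separated G g h
  replacement-separated e-edge f-edge e#f (pendant s∈e ((l~s , only-s) , support)) (pendant t∈f (leaf@(k~t , only-t) , _)) =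
    s≁t ,
    (λ s~k → disjoint⁻ e#f s∈e t∈f (only-t _ (Adj-sym s~k))) ,
    (λ l~t → disjoint⁻ e#f s∈e t∈f (sym (only-s _ l~t))) ,
    (λ l~k → case only-s _ l~k of λ { refl → s≁t k~t })
    where
    s≁t : ¬ Adj _ _
    -- The support condition makes `s` itself the leaf at `t`. Then the other end of `e`, being
    -- adjacent to `s`, is `t`, which lies on `f`.
    s≁t s~t with refl ← support _ _ s~t leaf
      with w , w∈e , s~w , _ ← partner s∈e e-edge = disjoint⁻ e#f w∈e t∈f (only-t _ s~w)
  replacement-separated _ _ _ (pendant _ pend) (triangle _ tri) =
    pendant-triangle-separated pend tri
  replacement-separated _ _ _ (triangle _ tri) (pendant _ pend) =
    Separated-sym (pendant-triangle-separated pend tri)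
  replacement-separated e-edge f-edge e#f (triangle {u} {v} {a} e⊆ tri) (triangle {u′} {v′} {a′} f⊆ tri′) =
    not-linked e⊆ f⊆ tri tri′ ,
    not-linked e⊆ (corner-sym ∘ f⊆) tri (pendantTriangle-sym tri′) ,
    not-linked (corner-sym ∘ e⊆) f⊆ (pendantTriangle-sym tri) tri′ ,
    not-linked (corner-sym ∘ e⊆) (corner-sym ∘ f⊆) (pendantTriangle-sym tri) (pendantTriangle-sym tri′)
    where
    not-linked : ∀ {u v u′ v′} → (∀ {x} → x ∈ᵉ _ → Corner G u v a x) →
                 (∀ {x} → x ∈ᵉ _ → Corner G u′ v′ a′ x) →
                 PendantTriangle G u v a → PendantTriangle G u′ v′ a′ → ¬ Adj u u′
    not-linked e⊆ f⊆ tri tri′ u~u′ =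
      same-triangle e-edge f-edge e#f e⊆ (linked-triangles tri tri′ u~u′ ∘ f⊆)

  -- Each edge is replaced independently of the others, and by `replacement-separated` the
  -- replacements of disjoint edges are separated. `replaceAll` therefore records the origin of each
  -- new edge.
  matching⇒separated : CameronWalker G → ∀ {M} → Matching M → HasSeparated G (length M)
  matching⇒separated cw (edges , disj) =
    let N , len , edgesᴺ , sep , _ = replaceAll edges disj in N , len , edgesᴺ , sep
    where
    replaceAll : ∀ {M} → All IsEdge M → AllPairs Disjoint M →
      ∃[ N ] length N ≡ length M × All IsEdge N × AllPairs (Separated G) N ×
             All (λ h → ∃[ f ] f List.∈ M × Replacement f h) N
    replaceAll []                []           = [] , refl , [] , [] , []
    replaceAll (e-edge ∷ edges) (e# ∷ disj) =
      let N , len , edgesᴺ , sep , from-M = replaceAll edges disj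
          g , e↦g = replace cw e-edge
      in  g ∷ N , cong suc len , replacement-edge e↦g ∷ edgesᴺ ,
          All.map (λ (f , f∈M , f↦h) → replacement-separated e-edge (All.lookup edges f∈M)
                                          (All.lookup e# f∈M) e↦g f↦h) from-M ∷ sep ,
          (_ , here refl , e↦g) ∷ All.map (λ (f , f∈M , f↦h) → f , there f∈M , f↦h) from-M

  -- From the criterion to equality of the parameters

  separated⇒disconnected : ∀ {M} → 2 ≤ length M → SeparatedEdges G M → DisconnectedMatching M
  separated⇒disconnected {_ ∷ []}    (s≤s ()) _
  separated⇒disconnected {e ∷ f ∷ M} _ separated@(_ , (e# ∷ _)) =
    split⇒disconnected {A = []} (separatedEdges⇒matching separated) (e# ∷ [])

  -- An induced matching with at least two edges is disconnected, so the bound on disconnected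
  -- matchings covers it; a smaller one has size below `k` anyway.
  ν-equal : ∀ {k} → 2 ≤ k → HasSeparated G k →
            (∀ M → DisconnectedMatching M → length M ≤ k) → ν-d≡ν-s G
  ν-equal {k} 2≤k (M , refl , separated) bound =
    k , ((M , separated⇒disconnected 2≤k separated , refl) , bound)
      , ((M , from inducedMatching⇔separatedEdges separated , refl) , induced-bound)
    where
    induced-bound : ∀ N → InducedMatching N → length N ≤ k
    induced-bound N induced with 2 ≤? length N
    ... | yes 2≤ = bound N (separated⇒disconnected 2≤ (to inducedMatching⇔separatedEdges induced))
    ... | no  2≰ = ≤-trans (<⇒≤ (≰⇒> 2≰)) 2≤k

  split⇒hasSplit : ∀ A B → Matching (A ++ B) → AllSeparated A B →
                   HasSplit G (length A) (length A + length B)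
  split⇒hasSplit A B matching sep = A ++ B , length-++ A , matching ,
    subst₂ (AllSeparated) (sym (take-length-++ A B)) (sym (drop-length-++ A B)) sep

  shrink : ∀ j {M} → 3 + j ≤ length M → DisconnectedMatching M →
           ∃[ p ] p < 2 + j × HasSplit G (suc p) (3 + j)
  shrink j {M} long disconnected with disconnected⇒split disconnected
  ... | inj₁ refl = contradiction long λ ()
  ... | inj₂ (e , A , f , B , M↭ , sep) =
    p , s≤s p≤ , subst₂ (HasSplit G) (cong suc lenA)
      (begin-equality
        suc (length (take p A)) + suc (length (take q B)) ≡⟨ cong₂ (λ a b → suc a + suc b) lenA lenB ⟩
        suc p + suc q                                     ≡⟨ cong suc (+-suc p q) ⟩
        2 + (p + q)                                       ≡⟨ cong (2 +_) (m+[n∸m]≡n p≤) ⟩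
        3 + j                                             ∎)
      (split⇒hasSplit (e ∷ take p A) (f ∷ take q B)
        (All.++⁺ (All.take⁺ (suc p) edgesA) (All.take⁺ (suc q) edgesB) ,
         AllPairs.++⁺ (AllPairs.take⁺ (suc p) disjA) (AllPairs.take⁺ (suc q) disjB)
           (All.take⁺ (suc p) (All.map (All.take⁺ (suc q)) cross)))
        (All.take⁺ (suc p) (All.map (All.take⁺ (suc q)) sep)))
    where
    open ≤-Reasoning
    p q : ℕ
    -- Besides `e` and `f`, `1 + j` edges are to be kept: as many as possible from `A`, the others
    -- from `B`.
    p = length A ⊓ suc j
    q = suc j ∸ p
    p≤ : p ≤ suc j
    p≤ = m⊓n≤n (length A) (suc j)
    lenA : length (take p A) ≡ p
    lenA = length-take-≤ (m⊓n≤m (length A) (suc j))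
    1+j≤ : suc j ≤ length A + length B
    1+j≤ = s≤s⁻¹ (s≤s⁻¹ (begin
      3 + j                                ≤⟨ long ⟩
      length M                             ≡⟨ ↭-length M↭ ⟩
      length ((e ∷ A) ++ (f ∷ B))          ≡⟨ length-++ (e ∷ A) ⟩
      suc (length A + suc (length B))      ≡⟨ cong suc (+-suc (length A) (length B)) ⟩
      2 + (length A + length B)            ∎))
    lenB : length (take q B) ≡ q
    lenB = length-take-≤ (begin
      suc j ∸ (length A ⊓ suc j)  ≡⟨ ∸-distribˡ-⊓-⊔ (suc j) (length A) (suc j) ⟩
      (suc j ∸ length A) ⊔ (suc j ∸ suc j)  ≡⟨ cong ((suc j ∸ length A) ⊔_) (n∸n≡0 (suc j)) ⟩
      (suc j ∸ length A) ⊔ 0      ≡⟨ ⊔-identityʳ _ ⟩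
      suc j ∸ length A            ≤⟨ m≤n+o⇒m∸n≤o (suc j) (length A) 1+j≤ ⟩
      length B                    ∎)
    matching = All-resp-↭ M↭ (proj₁ (proj₁ disconnected))
    edgesA = proj₁ (All.++⁻ (e ∷ A) matching)
    edgesB = proj₂ (All.++⁻ (e ∷ A) matching)
    disj = AllPairs-++⁻ (e ∷ A) (AllPairs-resp-↭ (λ {x} {y} → Disjoint-sym {x} {y}) M↭ (proj₂ (proj₁ disconnected)))
    disjA = proj₁ disj
    disjB = proj₁ (proj₂ disj)
    cross = proj₂ (proj₂ disj)

  hasSplit⇒disconnected : ∀ {p j} → p < 2 + j → HasSplit G (suc p) (3 + j) →
                          ∃[ M ] length M ≡ 3 + j × DisconnectedMatching M
  hasSplit⇒disconnected {p} {j} p<2+j (M , len , matching , sep) =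
    M , len , go M len matching sep
    where
    go : ∀ M → length M ≡ 3 + j → Matching M → AllSeparated (take (suc p) M) (drop (suc p) M) →
         DisconnectedMatching M
    go (e ∷ M) len matching sep with drop p M in eq
    -- The tail `M` has `2 + j` edges and `p < 2 + j`, so the second side is nonempty.
    ... | [] = contradiction
      (trans (sym (cong length eq)) (trans (length-drop p M) (cong (_∸ p) (suc-injective len))))
      (>⇒≢ (m<n⇒0<n∸m p<2+j) ∘ sym)
    ... | f ∷ B = subst DisconnectedMatching M≡
                    (split⇒disconnected (subst Matching (sym M≡) matching) sep)
      where
      M≡ : (e ∷ take p M) ++ (f ∷ B) ≡ e ∷ M
      M≡ = cong (e ∷_) (trans (cong (take p M ++_) (sym eq)) (take++drop≡id p M))

  criterion⇒ν-d≡ν-s : ∀ D → Criterion G D → ν-d≡ν-s G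
  criterion⇒ν-d≡ν-s D (inj₁ edgeless) =
    0 , (([] , (([] , []) , inj₂ refl) , refl) , λ M (matching , _) → bound M matching)
      , (([] , (([] , []) , inj₂ refl) , refl) , λ M (matching , _) → bound M matching)
    where
    bound : ∀ M → Matching M → length M ≤ 0
    bound []      _                = z≤n
    bound (e ∷ M) (u~v ∷ _ , _) = contradiction u~v (edgeless _ _)
  criterion⇒ν-d≡ν-s D (inj₂ (inj₁ (cw , two))) =
    -- The order bounds the sizes, since the first ends of the edges are distinct; the given pair of
    -- separated edges makes the maximum at least 2.
    let k , 2≤k , has , max = maximum (λ k → definable⇒dec (hasSeparatedᵈ k) G []) order
          (λ { k (M , refl , separated) → ≤-trans
             (matching-bound (proj₂ (separatedEdges⇒matching separated)) Subset.⊤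
               (All.tabulate λ {e} _ → proj₁ e , inj₁ refl , ∈⊤))
             (∣p∣≤n (Subset.⊤ {order})) }) two
    in  ν-equal 2≤k has λ M (matching , _) → max _ (matching⇒separated cw matching)
  criterion⇒ν-d≡ν-s D (inj₂ (inj₂ small)) =
    let j , _ , has , none = find small
    in  ν-equal (m≤m+n 2 j) has λ M disconnected → ≮⇒≥ λ long →
          let p , p< , split = shrink j long disconnected
          in  All.lookup none (∈-upTo⁺ p<) split

  -- Large optimal induced matchings force the local condition

  module LargeInduced {D M} (Δ≤D : Δ ≤ D) (separated : SeparatedEdges G M)
                      (large : 2 + (D + D) ≤ length M)
                      (maximal : ∀ N → DisconnectedMatching N → length N ≤ length M) where

    edges : All IsEdge M
    edges = proj₁ separated

    Free : Vertex → Set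
    Free x = ¬ Any (x ∈ᵉ_) M

    -- Some edge e of L is far from a and b.  So after K is exchanged for X,
    -- the edge e is still separated from all other edges.
    no-exchange : ∀ K L X a b → M ↭ K ++ L → length K ≤ 1 → Free a → Free b →
                  All IsEdge X → AllPairs Disjoint X →
                  All (λ x → ∀ {p} → p ∈ᵉ x → Any (p ∈ᵉ_) K ⊎ p ≡ a ⊎ p ≡ b) X →
                  length X ≢ suc (length K)
    no-exchange K L []       a b M↭ short freeᵃ freeᵇ edgesX disjX endsX ()
    no-exchange K L (x ∷ X) a b M↭ short freeᵃ freeᵇ edgesX disjX endsX lenX
      with sepK , sepL , cross ← AllPairs-++⁻ K (AllPairs-resp-↭ Separated-sym M↭ (proj₂ separated))
      with escape (AllPairs-map-∈ (λ _ f∈L → separated⇒disjoint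
                       (All.lookup (All.++⁻ʳ K (All-resp-↭ M↭ edges)) f∈L)) sepL)
                    (neighbours a ∪ neighbours b) far
      where
      open ≤-Reasoning
      -- At least `1 + (D + D)` edges remain in `L`, while `a` and `b` have at most `D + D`
      -- neighbours together.
      far : ∣ neighbours a ∪ neighbours b ∣ < length L
      far = begin-strict
        ∣ neighbours a ∪ neighbours b ∣  ≤⟨ ∣p∪q∣≤∣p∣+∣q∣ (neighbours a) (neighbours b) ⟩
        degree a + degree b              ≤⟨ +-mono-≤ (≤-trans (degree≤Δ a) Δ≤D) (≤-trans (degree≤Δ b) Δ≤D) ⟩
        D + D                            <⟨ s≤s⁻¹ (begin
          2 + (D + D)                      ≤⟨ large ⟩
          length M                         ≡⟨ trans (↭-length M↭) (length-++ K) ⟩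
          length K + length L              ≤⟨ +-monoˡ-≤ (length L) short ⟩
          1 + length L                     ∎) ⟩
        length L                         ∎
    ... | e , e∈L , e∉N with L′ , L↭ ← ∈⇒↭ e∈L =
      contradiction (maximal N (split⇒disconnected matching sepN)) (<⇒≱ longer)
      where
      -- The edge `e` is one side of the split and everything else the other, so `N` is
      -- disconnected, with one edge more than `M`.
      N : List EndpointPair
      N = (e ∷ []) ++ (x ∷ X) ++ L′
      edgesL : All IsEdge L
      edgesL = All.++⁻ʳ K (All-resp-↭ M↭ edges)
      edgesL′ : All IsEdge (e ∷ L′)
      edgesL′ = All-resp-↭ L↭ edgesL
      sepL′ : AllPairs (Separated G) (e ∷ L′)
      sepL′ = AllPairs-resp-↭ Separated-sym L↭ sepL
      L′⊆L : ∀ {f} → f List.∈ L′ → f List.∈ L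
      L′⊆L f∈L′ = ∈-resp-↭ (↭-sym L↭) (there f∈L′)
      L⊆M : ∀ {f} → f List.∈ L → f List.∈ M
      L⊆M f∈L = ∈-resp-↭ (↭-sym M↭) (∈-++⁺ʳ K f∈L)
      X-disjoint-L : ∀ {y f} → y List.∈ (x ∷ X) → f List.∈ L → Disjoint y f
      X-disjoint-L {y} {f} y∈X f∈L = disjoint⁺ {y} {f} λ {p} {q} p∈y q∈f →
        case All.lookup endsX y∈X p∈y of λ where
          (inj₁ p∈K) → let k , k∈K , p∈k = find p∈K in
            disjoint⁻ (separated⇒disjoint (All.lookup edgesL f∈L)
              (All.lookup (All.lookup cross k∈K) f∈L)) p∈k q∈f
          (inj₂ (inj₁ refl)) refl → freeᵃ (lose (L⊆M f∈L) q∈f)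
          (inj₂ (inj₂ refl)) refl → freeᵇ (lose (L⊆M f∈L) q∈f)
      e-separated-X : ∀ {y} → y List.∈ (x ∷ X) → Separated G e y
      e-separated-X y∈X = separated⁺ λ q∈e p∈y q~p →
        case All.lookup endsX y∈X p∈y of λ where
          (inj₁ p∈K) → let k , k∈K , p∈k = find p∈K in
            separated⁻ (All.lookup (All.lookup cross k∈K) e∈L) p∈k q∈e (Adj-sym q~p)
          (inj₂ (inj₁ refl)) → e∉N q∈e (x∈p∪q⁺ (inj₁ (neighbours⁺ (Adj-sym q~p))))
          (inj₂ (inj₂ refl)) → e∉N q∈e (x∈p∪q⁺ (inj₂ (neighbours⁺ (Adj-sym q~p))))
      sepN : AllSeparated (e ∷ []) ((x ∷ X) ++ L′)
      sepN = All.++⁺ (All.tabulate e-separated-X) (AllPairs.head sepL′) ∷ []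
      restEdges : All IsEdge ((x ∷ X) ++ L′)
      restEdges = All.++⁺ edgesX (All.tail edgesL′)
      matching : Matching N
      matching = All.head edgesL′ ∷ restEdges ,
        All.zipWith (λ (f-edge , e#f) → separated⇒disjoint f-edge e#f)
          (restEdges , All.head sepN) ∷
        AllPairs.++⁺ disjX
          (AllPairs-map-∈ (λ _ f∈L′ → separated⇒disjoint (All.lookup edgesL (L′⊆L f∈L′)))
            (AllPairs.tail sepL′))
          (All.tabulate λ y∈X → All.tabulate λ f∈L′ → X-disjoint-L y∈X (L′⊆L f∈L′))
      longer : length M < length N
      longer = ≤-reflexive (cong suc (begin-equality
        length M                             ≡⟨ trans (↭-length M↭) (length-++ K) ⟩
        length K + length L                  ≡⟨ cong (length K +_) (↭-length L↭) ⟩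
        length K + suc (length L′)           ≡⟨ +-suc (length K) (length L′) ⟩
        suc (length K) + length L′           ≡⟨ cong (_+ length L′) lenX ⟨
        length (x ∷ X) + length L′           ≡⟨ length-++ (x ∷ X) ⟨
        length ((x ∷ X) ++ L′)               ∎))
        where open ≤-Reasoning

    -- Otherwise the edge between `a` and `b` could be added to `M`: an exchange with `K` empty.
    free-independent : ∀ {a b} → Free a → Free b → ¬ Adj a b
    free-independent {a} {b} freeᵃ freeᵇ a~b =
      no-exchange [] M ((a , b) ∷ []) a b ↭-refl z≤n freeᵃ freeᵇ
        (a~b ∷ []) ([] ∷ []) (inj₂ ∷ []) refl

    Matched : Vertex → Vertex → Set
    Matched x y = ∃[ e ] e List.∈ M × x ∈ᵉ e × y ∈ᵉ e × Adj x y × (∀ {z} → z ∈ᵉ e → z ≡ x ⊎ z ≡ y)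

    matched-sym : ∀ {x y} → Matched x y → Matched y x
    matched-sym (e , e∈M , x∈e , y∈e , x~y , only) =
      e , e∈M , y∈e , x∈e , Adj-sym x~y , Sum.swap ∘ only

    matched⇒adj : ∀ {x y} → Matched x y → Adj x y
    matched⇒adj (_ , _ , _ , _ , x~y , _) = x~y

    matched⇒¬free : ∀ {x y} → Matched x y → ¬ Free x
    matched⇒¬free (e , e∈M , x∈e , _) free = free (lose e∈M x∈e)

    matched-or-free : ∀ x → (∃[ y ] Matched x y) ⊎ Free x
    matched-or-free x with Any.any? (x ∈ᵉ?_) M
    ... | no  free = inj₂ free
    ... | yes x∈M  = let e , e∈M , x∈e = find x∈M
                         y , y∈e , x~y , only = partner x∈e (All.lookup edges e∈M)
                     in  inj₁ (y , e , e∈M , x∈e , y∈e , x~y , only)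

    free? : ∀ x → Dec (Free x)
    free? x = ¬? (Any.any? (x ∈ᵉ?_) M)

    matched-nbr : ∀ {x y w} → Matched x y → Adj x w → w ≡ y ⊎ Free w
    matched-nbr {x} {y} {w} (e , e∈M , x∈e , y∈e , x~y , only) x~w with free? w
    ... | yes free = inj₂ free
    ... | no ¬free with only (adjacent-in separated e∈M x∈e
                                (decidable-stable (Any.any? (w ∈ᵉ?_) M) ¬free) x~w)
    ...   | inj₁ refl = contradiction x~w Adj-irrefl
    ...   | inj₂ w≡y  = inj₁ w≡y

    -- If `a` and `b` differed, the matching edge of `u` and `v` could be exchanged for the two
    -- edges to `a` and `b`.
    common-free-nbr : ∀ {u v a b} → Matched u v → Free a → Free b → Adj u a → Adj v b → a ≡ b
    common-free-nbr {u} {v} {a} {b} m@(e , e∈M , u∈e , v∈e , u~v , only) freeᵃ freeᵇ u~a v~b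
      with L , M↭ ← ∈⇒↭ e∈M = decidable-stable (a Fin.≟ b) λ a≢b →
      no-exchange (e ∷ []) L ((u , a) ∷ (v , b) ∷ []) a b M↭ ≤-refl freeᵃ freeᵇ
        (u~a ∷ v~b ∷ [])
        (((Adj⇒≢ u~v , (λ { refl → matched⇒¬free m freeᵇ }) ,
           (λ { refl → matched⇒¬free (matched-sym m) freeᵃ }) , a≢b) ∷ []) ∷ [] ∷ [])
        ((λ { (inj₁ refl) → inj₁ (here u∈e) ; (inj₂ refl) → inj₂ (inj₁ refl) }) ∷
         (λ { (inj₁ refl) → inj₁ (here v∈e) ; (inj₂ refl) → inj₂ (inj₂ refl) }) ∷ [])
        refl

    -- A leaf at `a` cannot be free, as free vertices are independent. It cannot be matched either,
    -- as its only neighbour `a` would be its partner.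
    free-leafless : ∀ {a} → Free a → ∀ l → ¬ Leaf G l a
    free-leafless freeᵃ l (l~a , only-a) with matched-or-free l
    ... | inj₂ freeˡ   = free-independent freeˡ freeᵃ l~a
    ... | inj₁ (k , m) with refl ← only-a k (matched⇒adj m) = matched⇒¬free (matched-sym m) freeᵃ

    -- Since `M` is induced, the neighbours of a matched vertex are its partner and free vertices,
    -- so `l` is a leaf. The neighbours of `s` are `l` and free vertices: free ones have no leaves,
    -- and a leaf at `l` is `s`.
    pendant⁺ : ∀ {s l} → Matched l s → (∀ a → Adj l a → ¬ Free a) → Pendant G s l
    pendant⁺ {s} {l} m no-free = (matched⇒adj m , λ w l~w → only l~w) , support
      where
      only : ∀ {w} → Adj l w → w ≡ s
      only l~w = case matched-nbr m l~w of λ where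
        (inj₁ w≡s)  → w≡s
        (inj₂ free) → contradiction free (no-free _ l~w)
      support : ∀ t k → Adj s t → Leaf G k t → k ≡ s
      support t k s~t leaf with matched-nbr (matched-sym m) s~t
      ... | inj₁ refl = only (Adj-sym (proj₁ leaf))
      ... | inj₂ free = contradiction leaf (free-leafless free k)

    -- By `common-free-nbr`, any free neighbour of `u` equals any free neighbour of `v`, so both
    -- ends have `a` as their one free neighbour.
    triangle⁺ : ∀ {u v a b} → Matched u v → Free a → Free b → Adj u a → Adj v b →
                PendantTriangle G u v a
    triangle⁺ {u} {v} {a} {b} m freeᵃ freeᵇ u~a v~b =
      matched⇒adj m , u~a , v~a ,
      (λ w u~w → Sum.map₂ (λ free → common-free-nbr m free freeᵃ u~w v~a) (matched-nbr m u~w)) ,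
      (λ w v~w → Sum.map₂ (λ free → sym (common-free-nbr m freeᵃ free u~a v~w))
                          (matched-nbr (matched-sym m) v~w)) ,
      free-leafless freeᵃ
      where
      v~a : Adj v a
      v~a = subst (Adj v) (sym (common-free-nbr m freeᵃ freeᵇ u~a v~b)) v~b

    free-nbr? : ∀ u → Dec (∃[ a ] Adj u a × Free a)
    free-nbr? u = Fin.any? (λ a → Adj? u a ×-dec free? a)

    classify : ∀ {u v} → Matched u v →
               Pendant G u v ⊎ Pendant G v u ⊎ ∃[ a ] PendantTriangle G u v a
    classify {u} {v} m = decide (free-nbr? u) (free-nbr? v)
      where
      decide : Dec (∃[ a ] Adj u a × Free a) → Dec (∃[ b ] Adj v b × Free b) →
               Pendant G u v ⊎ Pendant G v u ⊎ ∃[ a ] PendantTriangle G u v a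
      decide (no ¬a) _ = inj₂ (inj₁ (pendant⁺ m λ a u~a free → ¬a (a , u~a , free)))
      decide _ (no ¬b) = inj₁ (pendant⁺ (matched-sym m) λ b v~b free → ¬b (b , v~b , free))
      decide (yes (a , u~a , freeᵃ)) (yes (b , v~b , freeᵇ)) =
        inj₂ (inj₂ (a , triangle⁺ m freeᵃ freeᵇ u~a v~b))

    matched-end : ∀ {x y x′} → Adj x y → Matched x x′ → AtPendant G (x , y) ⊎ InTriangle G (x , y)
    matched-end {x} {y} {x′} x~y m with classify m
    ... | inj₁ pend = inj₁ (x , x′ , inj₁ refl , pend)
    ... | inj₂ (inj₁ pend@((_ , only) , _)) with refl ← only y x~y = inj₁ (y , x , inj₂ refl , pend)
    ... | inj₂ (inj₂ (a , tri)) = inj₂ (x , x′ , a , tri , inj₁ refl , corner-nbr tri x~y)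

    -- Free vertices are independent, so every edge has a matched end, and the type of the matching
    -- edge there decides the case.
    cameronWalker : CameronWalker G
    cameronWalker x y x~y with matched-or-free x | matched-or-free y
    ... | inj₁ (_ , m) | _            = matched-end x~y m
    ... | inj₂ freeˣ   | inj₂ freeʸ   = contradiction x~y (free-independent freeˣ freeʸ)
    ... | inj₂ _       | inj₁ (_ , m) = Sum.map
      (λ (s , l , s∈ , pend) → s , l , Sum.swap s∈ , pend)
      (λ (u , v , a , tri , y∈ , x∈) → u , v , a , tri , x∈ , y∈)
      (matched-end (Adj-sym x~y) m)

  -- From equality of the parameters to the criterion

  hasSeparated-take : ∀ {k l} → k ≤ l → HasSeparated G l → HasSeparated G k
  hasSeparated-take {k} k≤l (M , refl , edges , sep) =
    take k M , length-take-≤ k≤l , All.take⁺ k edges , AllPairs.take⁺ k sep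

  -- Cases on the common value. A single edge is an induced matching, so 0 means that there are no
  -- edges, and a split has at least two edges, so 1 is impossible. From `2 + (D + D)` on,
  -- `LargeInduced` applies; below it, a split matching of size `3 + j` would exceed the maximum.
  ν-d≡ν-s⇒criterion : ∀ {D} → Δ ≤ D → ν-d≡ν-s G → Criterion G D
  ν-d≡ν-s⇒criterion _ (0 , _ , (_ , maxˢ)) = inj₁ λ u v u~v →
    contradiction
      (maxˢ ((u , v) ∷ []) (from inducedMatching⇔separatedEdges (u~v ∷ [] , [] ∷ []))) λ ()
  ν-d≡ν-s⇒criterion _ (1 , ((N , disconnected , len) , _) , _) with disconnected⇒split disconnected
  ... | inj₁ refl = case len of λ ()
  ... | inj₂ (e , A , f , B , N↭ , _) = contradiction
    (trans (sym len) (trans (↭-length N↭) (length-++ (e ∷ A))))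
    (<⇒≢ (s≤s (≤-trans (s≤s z≤n) (m≤n+m (suc (length B)) (length A)))))
  ν-d≡ν-s⇒criterion {D} Δ≤D (suc (suc j) , (_ , maxᵈ) , ((M , induced , len) , _)) with j <? D + D
  ... | yes j< = inj₂ (inj₂ (lose (∈-upTo⁺ j<) (has , All.tabulate λ p∈ split →
          let N , len , disconnected = hasSplit⇒disconnected (∈-upTo⁻ p∈) split
          in  <⇒≱ (≤-reflexive (sym len)) (maxᵈ N disconnected))))
    where
    has : HasSeparated G (2 + j)
    has = M , len , to inducedMatching⇔separatedEdges induced
  ... | no j≮ = inj₂ (inj₁ (LargeInduced.cameronWalker Δ≤D separated
          (subst (2 + (D + D) ≤_) (sym len) (+-monoʳ-≤ 2 (≮⇒≥ j≮)))
          (λ N disconnected → subst (length N ≤_) (sym len) (maxᵈ N disconnected)) ,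
          hasSeparated-take (m≤m+n 2 j) (M , len , separated)))
    where
    separated : SeparatedEdges G M
    separated = to inducedMatching⇔separatedEdges induced

theorem23 : (D : ℕ) →
    PolynomialTimeDecidable encodeGraph (λ G → Graph.Δ G ≤ D) ν-d≡ν-s
theorem23 D = definable⇒polynomialTime (criterionᵈ D) λ G Δ≤D →
  mk⇔ (ν-d≡ν-s⇒criterion G Δ≤D) (criterion⇒ν-d≡ν-s G D)
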